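{- For each $n\geq 1$, $$\max_{w\in\widetilde S_n}\lvert D_R(\widetilde{\mathtt s}(w))\rvert=\left\lfloor\frac n2\right\rfloor,$$ where $\widetilde{\mathtt s}:\widetilde S_n\to\widetilde S_n$ is the affine stack-sorting map.
   Context: An affine permutation of size $n$ is a bijection $w:\mathbb Z\to\mathbb Z$ with $w(i+n)=w(i)+n$ for all $i\in\mathbb Z$ and $\sum_{i=1}^n w(i)=\binom{n+1}{2}$. They form the affine symmetric group $\widetilde S_n$ under composition (trivial if $n=1$), a Coxeter group with simple generators $\widetilde s_1,\ldots,\widetilde s_n$, where $\widetilde s_i$ swaps $i+mn$ and $i+mn+1$ for all $m\in\mathbb Z$ and fixes all other integers. The right descent set is $D_R(w)=\{\widetilde s_i:1\le i\le n,\ w(i)>w(i+1)\}$. The left weak order is $x\leq_L y\iff\ell(yx^{ -1})=\ell(y)-\ell(x)$, $\ell$ being Coxeter length. Affine sylvester congruence. For $w\in\widetilde S_n$ define a partial order $\preceq_w$ on $\mathbb Z$ (positions): for $i<j$, the positions $i,j$ are incomparable if and only if there is $k$ with $i<k<j$ and $w(k)>\max\{w(i),w(j)\}$; otherwise the position with the smaller value of $w$ is below the other. (This is the descendant order of the decreasing affine binary plane tree with in-order reading $w$.) The affine sylvester congruence is $v\equiv_{\widetilde{\mathrm{syl}}}w\iff{\preceq_v}={\preceq_w}$; it is a semilattice congruence on $(\widetilde S_n,\leq_L)$ in which $\{e\}$ is a class, and each class has a unique $\leq_L$-minimal element. Let $\pi_\downarrow(w)$ be the minimal element of the class of $w$.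 The affine stack-sorting map is $\widetilde{\mathtt s}(w)=w\,(\pi_\downarrow(w))^{ -1}$. -}

module Defs where

open import Level using (0ℓ)
open import Data.Nat.Base as ℕ using (ℕ; zero; suc; z<s)
import Data.Nat.Properties as ℕ
import Data.Nat.Combinatorics as ℕ
open import Data.Integer.Base
  using (ℤ; +_; -[1+_]; 1ℤ; _+_; _*_; _-_; -_; _≤_; _<_; _⊓_; _⊔_; +≤+; +<+; _/ℕ_; _%ℕ_)
import Data.Integer.Base as ℤ
import Data.Integer.Properties as ℤ
import Data.Integer.DivMod as ℤ
open import Data.Integer.Tactic.RingSolver using (solve-∀)
open import Data.Fin.Base using (Fin; toℕ; fromℕ<)
import Data.Fin.Properties as Fin
open import Data.Fin.Permutation using (Permutation; permutation)
open import Data.Fin.Subset using (Subset)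
open import Data.Vec.Base using (Vec; foldr′; tabulate)
open import Data.Product.Base using (Σ-syntax; ∃-syntax; _×_; _,_; proj₁; proj₂)
open import Function.Base using (_∘_)
open import Function.Bundles using (_↔_; _⇔_; mk↔ₛ′; module Inverse)
open import Function.Construct.Composition using (_↔-∘_)
open import Function.Construct.Identity using (↔-id)
open import Function.Construct.Symmetry using (↔-sym)
open import Algebra.Bundles using (Group)
import Algebra.Properties.AbelianGroup ℤ.+-0-abelianGroup as ℤ+
open import Algebra.Properties.CommutativeMonoid.Sum ℤ.+-0-commutativeMonoid
  using (sum; sum-cong-≗; ∑-distrib-+; sum-permute)
open import Relation.Binary.Core using (Rel)
open import Relation.Binary.Definitions using (tri<; tri≈; tri>)
open import Relation.Binary.PropositionalEquality
  using (_≡_; _≢_; _≗_; refl; sym; trans; cong; cong₂; module ≡-Reasoning)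
open import Relation.Nullary using (¬_; does; contradiction)

-- Fin n enumerates the integers 1, …, n.
pos : ∀ {n} → Fin n → ℤ
pos i = + suc (toℕ i)

record AffPerm (n : ℕ) : Set where
  field
    perm      : ℤ ↔ ℤ
  open Inverse perm public using (to; from; strictlyInverseˡ; strictlyInverseʳ)
  field
    periodic  : ∀ i → to (i + + n) ≡ to i + + n
    sum-value : sum {n} (λ k → to (pos k)) ≡ + (suc n ℕ.C 2)

infixl 9 _⟨_⟩
_⟨_⟩ : ∀ {n} → AffPerm n → ℤ → ℤ
w ⟨ i ⟩ = AffPerm.to w i

------------------------------------------------------------------------
-- Affine permutations form a group

sum-pos : ∀ n → sum {n} pos ≡ + (suc n ℕ.C 2)
sum-pos n = begin
  sum {n} pos                              ≡⟨ sum-cong-≗ {n} (λ k → cong +_ (ℕ.+-identityʳ (suc (toℕ k)))) ⟨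
  sum {n} (λ k → + (suc (toℕ k) ℕ.+ 0))    ≡⟨ go n 0 ⟩
  + ((n ℕ.+ 1) ℕ.C 2 ℕ.+ n ℕ.* 0)          ≡⟨ cong (λ x → + ((n ℕ.+ 1) ℕ.C 2 ℕ.+ x)) (ℕ.*-zeroʳ n) ⟩
  + ((n ℕ.+ 1) ℕ.C 2 ℕ.+ 0)                ≡⟨ cong +_ (ℕ.+-identityʳ _) ⟩
  + ((n ℕ.+ 1) ℕ.C 2)                      ≡⟨ cong (λ m → + (m ℕ.C 2)) (ℕ.+-comm n 1) ⟩
  + (suc n ℕ.C 2)                          ∎
  where
  open ≡-Reasoning
  -- Σ_{k<n} (k + 1 + c), in the form needed for induction on n
  go : ∀ n c → sum {n} (λ k → + (suc (toℕ k) ℕ.+ c)) ≡ + ((n ℕ.+ 1) ℕ.C 2) + + (n ℕ.* c)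
  go zero    c = refl
  go (suc n) c = begin
    + suc c + sum {n} (λ k → + (suc (suc (toℕ k)) ℕ.+ c))
      ≡⟨ cong (_+_ (+ suc c)) (sum-cong-≗ {n} λ k → cong +_ (sym (ℕ.+-suc (suc (toℕ k)) c))) ⟩
    + suc c + sum {n} (λ k → + (suc (toℕ k) ℕ.+ suc c))
      ≡⟨ cong (_+_ (+ suc c)) (go n (suc c)) ⟩
    + (suc c ℕ.+ ((n ℕ.+ 1) ℕ.C 2 ℕ.+ n ℕ.* suc c))
      ≡⟨ cong +_ (lem n c ((n ℕ.+ 1) ℕ.C 2)) ⟩
    + ((n ℕ.+ 1 ℕ.+ (n ℕ.+ 1) ℕ.C 2) ℕ.+ suc n ℕ.* c)
      ≡⟨ cong (λ x → + (x ℕ.+ suc n ℕ.* c)) pascal ⟩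
    + ((suc n ℕ.+ 1) ℕ.C 2 ℕ.+ suc n ℕ.* c) ∎
    where
    import Data.Nat.Tactic.RingSolver as Nat
    lem : ∀ n c b → suc c ℕ.+ (b ℕ.+ n ℕ.* suc c) ≡ (n ℕ.+ 1 ℕ.+ b) ℕ.+ suc n ℕ.* c
    lem = Nat.solve-∀
    pascal : n ℕ.+ 1 ℕ.+ (n ℕ.+ 1) ℕ.C 2 ≡ (suc n ℕ.+ 1) ℕ.C 2
    pascal = trans (cong (ℕ._+ (n ℕ.+ 1) ℕ.C 2) (sym (ℕ.nC1≡n (n ℕ.+ 1))))
                   (ℕ.nCk+nC[k+1]≡[n+1]C[k+1] (n ℕ.+ 1) 1)

module _ {n : ℕ} where

  periodic-* : (f : ℤ → ℤ) → (∀ i → f (i + + n) ≡ f i + + n) →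
               ∀ i q → f (i + q * + n) ≡ f i + q * + n
  periodic-* f f-per = go
    where
    open ≡-Reasoning
    step : ∀ i q N → i + (1ℤ + q) * N ≡ (i + q * N) + N
    step = solve-∀
    back : ∀ i N → (i - N) + N ≡ i
    back = solve-∀
    f-per⁻ : ∀ i → f (i - + n) ≡ f i - + n
    f-per⁻ i = begin
      f (i - + n)               ≡⟨ lem (f (i - + n)) (+ n) ⟩
      (f (i - + n) + + n) - + n ≡⟨ cong (_- + n) (f-per (i - + n)) ⟨
      f (i - + n + + n) - + n   ≡⟨ cong (λ x → f x - + n) (back i (+ n)) ⟩
      f i - + n                 ∎
      where
      lem : ∀ x N → x ≡ (x + N) - N
      lem = solve-∀
    goes⁺ : ∀ i m → f (i + + m * + n) ≡ f i + + m * + n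
    goes⁺ i zero    = trans (cong f (ℤ.+-identityʳ i)) (sym (ℤ.+-identityʳ (f i)))
    goes⁺ i (suc m) = begin
      f (i + + suc m * + n)     ≡⟨ cong f (step i (+ m) (+ n)) ⟩
      f (i + + m * + n + + n)   ≡⟨ f-per _ ⟩
      f (i + + m * + n) + + n   ≡⟨ cong (_+ + n) (goes⁺ i m) ⟩
      f i + + m * + n + + n     ≡⟨ step (f i) (+ m) (+ n) ⟨
      f i + + suc m * + n       ∎
    go : ∀ i q → f (i + q * + n) ≡ f i + q * + n
    go i (+ m)    = goes⁺ i m
    go i -[1+ m ] = begin
      f (i + -[1+ m ] * + n)
        ≡⟨ lem (f (i + -[1+ m ] * + n)) (+ suc m) (+ n) ⟩
      (f (i + - (+ suc m) * + n) + + suc m * + n) + - (+ suc m) * + n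
        ≡⟨ cong (_+ - (+ suc m) * + n) (goes⁺ (i + - (+ suc m) * + n) (suc m)) ⟨
      f (i + - (+ suc m) * + n + + suc m * + n) + - (+ suc m) * + n
        ≡⟨ cong (λ x → f x + - (+ suc m) * + n) (lem′ i (+ suc m) (+ n)) ⟩
      f i + -[1+ m ] * + n ∎
      where
      lem : ∀ x q N → x ≡ (x + q * N) + - q * N
      lem = solve-∀
      lem′ : ∀ x q N → x + - q * N + q * N ≡ x
      lem′ = solve-∀

module _ {n : ℕ} .{{_ : ℕ.NonZero n}} where

  residue : ℤ → Fin n
  residue j = fromℕ< (ℤ.n%ℕd<d (j - 1ℤ) n)

  quot : ℤ → ℤ
  quot j = (j - 1ℤ) /ℕ n

  residue-quot : ∀ j → j ≡ pos (residue j) + quot j * + n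
  residue-quot j = begin
    j                                             ≡⟨ lem j ⟩
    1ℤ + (j - 1ℤ)                                 ≡⟨ cong (_+_ 1ℤ) (ℤ.a≡a%ℕn+[a/ℕn]*n (j - 1ℤ) n) ⟩
    1ℤ + (+ ((j - 1ℤ) %ℕ n) + quot j * + n)       ≡⟨ ℤ.+-assoc 1ℤ (+ ((j - 1ℤ) %ℕ n)) (quot j * + n) ⟨
    + suc ((j - 1ℤ) %ℕ n) + quot j * + n          ≡⟨ cong (λ r → + suc r + quot j * + n) (Fin.toℕ-fromℕ< (ℤ.n%ℕd<d (j - 1ℤ) n)) ⟨
    pos (residue j) + quot j * + n                ∎
    where
    open ≡-Reasoning
    lem : ∀ j → j ≡ 1ℤ + (j - 1ℤ)
    lem = solve-∀

  private
    below : ∀ (a b : Fin n) {p q} → p < q → pos a + p * + n < pos b + q * + n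
    below a b {p} {q} p<q = begin-strict
      pos a + p * + n              ≤⟨ ℤ.+-monoˡ-≤ (p * + n) (+≤+ (Fin.toℕ<n a)) ⟩
      + n + p * + n                ≡⟨ lem (+ n) p ⟩
      ℤ.suc p * + n                ≤⟨ ℤ.*-monoʳ-≤-nonNeg (+ n) (ℤ.i<j⇒suc[i]≤j p<q) ⟩
      q * + n                      ≡⟨ ℤ.+-identityˡ _ ⟨
      + 0 + q * + n                <⟨ ℤ.+-monoˡ-< (q * + n) (+<+ z<s) ⟩
      pos b + q * + n              ∎
      where
      open ℤ.≤-Reasoning
      lem : ∀ N p → N + p * N ≡ (1ℤ + p) * N
      lem = solve-∀

  pos-unique : ∀ (a b : Fin n) p q → pos a + p * + n ≡ pos b + q * + n → a ≡ b
  pos-unique a b p q eq with ℤ.<-cmp p q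
  ... | tri< p<q _ _ = contradiction eq (ℤ.<⇒≢ (below a b p<q))
  ... | tri> _ _ q<p = contradiction (sym eq) (ℤ.<⇒≢ (below b a q<p))
  ... | tri≈ _ refl _ = Fin.toℕ-injective (ℕ.suc-injective (ℤ.+-injective
          (ℤ+.∙-cancelʳ (p * + n) (pos a) (pos b) eq)))

from-periodic : ∀ {n} (w : AffPerm n) → ∀ i → AffPerm.from w (i + + n) ≡ AffPerm.from w i + + n
from-periodic {n} w i = begin
  from (i + + n)             ≡⟨ cong (λ x → from (x + + n)) (strictlyInverseˡ i) ⟨
  from (to (from i) + + n)   ≡⟨ cong from (periodic (from i)) ⟨
  from (to (from i + + n))   ≡⟨ strictlyInverseʳ _ ⟩
  from i + + n               ∎
  where
  open AffPerm w
  open ≡-Reasoning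

-- A periodic bijection v permutes the residues mod n, and f j - j depends only
-- on the residue of j, so the displacement sums of f and v add under composition.
sum-∘ : ∀ {n} (f : ℤ → ℤ) → (∀ i → f (i + + n) ≡ f i + + n) →
        (v : ℤ ↔ ℤ) (let open Inverse v) →
        (∀ i → to (i + + n) ≡ to i + + n) → (∀ i → from (i + + n) ≡ from i + + n) →
        sum {n} (λ k → f (to (pos k))) + sum {n} pos ≡
        sum {n} (λ k → f (pos k)) + sum {n} (λ k → to (pos k))
sum-∘ {zero}      f f-per v _ _ = refl
sum-∘ {n@(suc _)} f f-per v to-per from-per = begin
  sum {n} (f ∘ to ∘ pos) + sum {n} pos
    ≡⟨ cong (_+_ (sum {n} (f ∘ to ∘ pos))) (sum-permute {n} pos π) ⟩
  sum {n} (f ∘ to ∘ pos) + sum {n} (pos ∘ ρ to)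
    ≡⟨ ∑-distrib-+ {n} (f ∘ to ∘ pos) (pos ∘ ρ to) ⟨
  sum {n} (λ k → f (to (pos k)) + pos (ρ to k))
    ≡⟨ sum-cong-≗ {n} pointwise ⟩
  sum {n} (λ k → f (pos (ρ to k)) + to (pos k))
    ≡⟨ ∑-distrib-+ {n} (f ∘ pos ∘ ρ to) (to ∘ pos) ⟩
  sum {n} (f ∘ pos ∘ ρ to) + sum {n} (to ∘ pos)
    ≡⟨ cong (_+ sum {n} (to ∘ pos)) (sum-permute {n} (f ∘ pos) π) ⟨
  sum {n} (f ∘ pos) + sum {n} (to ∘ pos) ∎
  where
  open Inverse v
  open ≡-Reasoning
  ρ : (ℤ → ℤ) → Fin n → Fin n
  ρ g k = residue (g (pos k))
  ρ-inv : (g h : ℤ → ℤ) → (∀ i → g (i + + n) ≡ g i + + n) → (∀ i → g (h i) ≡ i) →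
          ∀ k → ρ g (ρ h k) ≡ k
  ρ-inv g h g-per gh k = pos-unique (ρ g (ρ h k)) k (quot {n} (g (pos (ρ h k))) + q) (+ 0) (begin
    pos (ρ g (ρ h k)) + (quot {n} (g (pos (ρ h k))) + q) * + n
      ≡⟨ lem (pos (ρ g (ρ h k))) (quot {n} (g (pos (ρ h k)))) q (+ n) ⟩
    (pos (ρ g (ρ h k)) + quot {n} (g (pos (ρ h k))) * + n) + q * + n
      ≡⟨ cong (_+ q * + n) (residue-quot (g (pos (ρ h k)))) ⟨
    g (pos (ρ h k)) + q * + n
      ≡⟨ periodic-* g g-per (pos (ρ h k)) q ⟨
    g (pos (ρ h k) + q * + n)
      ≡⟨ cong g (residue-quot (h (pos k))) ⟨
    g (h (pos k))
      ≡⟨ gh (pos k) ⟩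
    pos k
      ≡⟨ ℤ.+-identityʳ (pos k) ⟨
    pos k + + 0 * + n ∎)
    where
    q = quot {n} (h (pos k))
    lem : ∀ a x y N → a + (x + y) * N ≡ (a + x * N) + y * N
    lem = solve-∀
  π : Permutation n n
  π = permutation (ρ to) (ρ from)
        (ρ-inv to from to-per strictlyInverseˡ) (ρ-inv from to from-per strictlyInverseʳ)
  pointwise : ∀ k → f (to (pos k)) + pos (ρ to k) ≡ f (pos (ρ to k)) + to (pos k)
  pointwise k = begin
    f (to (pos k)) + r               ≡⟨ cong (λ x → f x + r) (residue-quot (to (pos k))) ⟩
    f (r + q * + n) + r              ≡⟨ cong (_+ r) (periodic-* f f-per r q) ⟩
    (f r + q * + n) + r              ≡⟨ lem (f r) (q * + n) r ⟩
    f r + (r + q * + n)              ≡⟨ cong (_+_ (f r)) (residue-quot (to (pos k))) ⟨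
    f r + to (pos k)                 ∎
    where
    r = pos (ρ to k)
    q = quot {n} (to (pos k))
    lem : ∀ a b c → (a + b) + c ≡ a + (c + b)
    lem = solve-∀

-- Equality of affine permutations is equality of the underlying functions.
S̃ : ℕ → Group 0ℓ 0ℓ
S̃ n = record
  { Carrier = AffPerm n
  ; _≈_     = λ v w → to v ≗ to w
  ; _∙_     = _∙_
  ; ε       = ε
  ; _⁻¹     = _⁻¹
  ; isGroup = record
    { isMonoid = record
      { isSemigroup = record
        { isMagma = record
          { isEquivalence = record
            { refl  = λ _ → refl
            ; sym   = λ p i → sym (p i)
            ; trans = λ p q i → trans (p i) (q i)
            }
          ; ∙-cong = λ {x} {y} {u} {v} p q i → trans (cong (to x) (q i)) (p (to v i))
          }
        ; assoc = λ _ _ _ _ → refl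
        }
      ; identity = (λ _ _ → refl) , (λ _ _ → refl)
      }
    ; inverse = strictlyInverseʳ , strictlyInverseˡ
    ; ⁻¹-cong = λ {x} {y} p i → trans (cong (from x) (trans (sym (strictlyInverseˡ y i))
                  (sym (p (from y i))))) (strictlyInverseʳ x (from y i))
    }
  }
  where
  open AffPerm
  infixl 7 _∙_
  _∙_ : AffPerm n → AffPerm n → AffPerm n
  v ∙ w = record
    { perm      = perm v ↔-∘ perm w
    ; periodic  = λ i → trans (cong (to v) (periodic w i)) (periodic v (to w i))
    ; sum-value = trans
        (ℤ+.∙-cancelʳ (sum {n} pos) _ _
          (trans (sum-∘ {n} (to v) (periodic v) (perm w) (periodic w) (from-periodic w))
                 (cong (_+_ (sum {n} (to v ∘ pos))) (trans (sum-value w) (sym (sum-pos n))))))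
        (sum-value v)
    }
  ε : AffPerm n
  ε = record { perm = ↔-id ℤ ; periodic = λ _ → refl ; sum-value = sum-pos n }
  _⁻¹ : AffPerm n → AffPerm n
  w ⁻¹ = record
    { perm      = ↔-sym (perm w)
    ; periodic  = from-periodic w
    ; sum-value = ℤ+.∙-cancelˡ (sum {n} (to w ∘ pos)) _ _ (trans
        (sym (sum-∘ {n} (to w) (periodic w) (↔-sym (perm w)) (from-periodic w) (periodic w)))
        (cong₂ _+_
          (trans (sum-cong-≗ {n} λ k → strictlyInverseˡ w (pos k))
                 (trans (sum-pos n) (sym (sum-value w))))
          (sum-pos n)))
    }

------------------------------------------------------------------------
-- Coxeter length, weak order and descents

module _ {n : ℕ} where
  open Group (S̃ n) using (_≈_; _∙_; _⁻¹; ε)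

  -- For n = 1 no s satisfies this, so there are no generators, matching the
  -- triviality of the group.
  IsGenerator : Fin n → AffPerm n → Set
  IsGenerator i s =
    (∀ m → s ⟨ pos i + m * + n ⟩ ≡ pos i + m * + n + 1ℤ ×
           s ⟨ pos i + m * + n + 1ℤ ⟩ ≡ pos i + m * + n) ×
    (∀ j → (∀ m → j ≢ pos i + m * + n × j ≢ pos i + m * + n + 1ℤ) → s ⟨ j ⟩ ≡ j)

  Generator : Set
  Generator = Σ[ s ∈ AffPerm n ] ∃[ i ] IsGenerator i s

  IsWordFor : ∀ {k} → AffPerm n → Vec Generator k → Set
  IsWordFor w ss = foldr′ (λ s x → proj₁ s ∙ x) ε ss ≈ w

  HasLength : AffPerm n → ℕ → Set
  HasLength w k = (∃[ ss ] IsWordFor {k} w ss) ×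
                  (∀ m (ss : Vec Generator m) → IsWordFor w ss → k ℕ.≤ m)

  infix 4 _≤L_
  _≤L_ : Rel (AffPerm n) 0ℓ
  x ≤L y = ∃[ a ] ∃[ b ] ∃[ c ]
    HasLength (y ∙ x ⁻¹) a × HasLength y b × HasLength x c × + a ≡ + b - + c

  -- i stands for the generator s̃ᵢ, so that the cardinality is that of the set of
  -- generators; for n = 1, where there is no s̃₁, the set is empty.
  D_R : AffPerm n → Subset n
  D_R w = tabulate λ i → does (w ⟨ pos i + 1ℤ ⟩ ℤ.<? w ⟨ pos i ⟩)

------------------------------------------------------------------------
-- The affine sylvester congruence and stack-sorting

  infix 4 _[_≼_] _≡syl_

  Incomparable : AffPerm n → Rel ℤ 0ℓ
  Incomparable w i j = ∃[ k ] i < k × k < j × w ⟨ i ⟩ ⊔ w ⟨ j ⟩ < w ⟨ k ⟩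

  _[_≼_] : AffPerm n → Rel ℤ 0ℓ
  w [ i ≼ j ] = w ⟨ i ⟩ ≤ w ⟨ j ⟩ × ¬ Incomparable w (i ⊓ j) (i ⊔ j)

  _≡syl_ : Rel (AffPerm n) 0ℓ
  v ≡syl w = ∀ i j → v [ i ≼ j ] ⇔ w [ i ≼ j ]

  -- p = π↓(w)
  IsMinimalInClassOf : AffPerm n → AffPerm n → Set
  IsMinimalInClassOf w p = p ≡syl w × (∀ v → v ≡syl w → v ≤L p → v ≈ p)

  -- u = s̃(w). Every class has exactly one minimal element, so this is the graph
  -- of a total function; stating it as a relation avoids having to construct π↓.
  IsStackSortOf : AffPerm n → AffPerm n → Set
  IsStackSortOf w u = ∃[ p ] IsMinimalInClassOf w p × u ≈ w ∙ p ⁻¹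

IsMaximum : (ℕ → Set) → ℕ → Set
IsMaximum P m = P m × (∀ k → P k → k ℕ.≤ m)

-- A minimal element p of its class avoids the pattern 231: otherwise two consecutive values
-- sit in decreasing order around a larger one, and exchanging them stays in the class and
-- shortens p, because the length is the number of inversions modulo translation by n.
-- If u = w p⁻¹ has a descent at j, then p⁻¹(j) and p⁻¹(j + 1) are incomparable, and 231-avoidance
-- forces p⁻¹(j) < k < p⁻¹(j + 1) for some k with p(k) > j + 1. Two such positions p⁻¹(j + 1) are
-- never adjacent, for that would again create a 231; so at most half of the residues carry one.
-- Equality holds for p = s̃₂s̃₄⋯ and u = s̃₁s̃₃⋯ with ⌊n/2⌋ factors each.

module Submission where

open import Defs
open import Algebra.Bundles using (Group)
open import Data.Bool.Base using (Bool; true; false)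
open import Data.Empty using (⊥; ⊥-elim)
open import Data.Fin.Base using (Fin; zero; suc; toℕ; fromℕ<; combine; remQuot)
import Data.Fin.Properties as Fin
open import Data.Fin.Subset using (Subset; inside; outside; _∈_; _∉_; _⊆_; ∣_∣) renaming (⊥ to ∅)
open import Data.Fin.Subset.Properties using (p⊆q⇒∣p∣≤∣q∣; p⊂q⇒∣p∣<∣q∣; drop-there; _∈?_; ∣⊥∣≡0)
open import Data.Integer.Base as ℤ using (ℤ; +_; 0ℤ; 1ℤ; _+_; _-_; -_; _*_; _<_; _⊓_; _⊔_)
import Data.Integer.Properties as ℤ
open import Data.Integer.Tactic.RingSolver using (solve-∀)
open import Data.Nat.Base as ℕ using (ℕ; zero; suc; _≤_; ⌊_/2⌋; z≤n; s≤s; NonZero)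
import Data.Nat.Properties as ℕ
open import Data.Product.Base using (∃-syntax; _×_; _,_; proj₁; proj₂)
open import Data.Sum.Base using (_⊎_; inj₁; inj₂)
open import Data.Vec.Base using (Vec; []; _∷_; foldr′; tabulate; here; there)
open import Data.Vec.Properties using (lookup∘tabulate; tabulate-cong; lookup⇒[]=; []=⇒lookup)
open import Function.Base using (_∘_; case_of_)
open import Function.Bundles using (_↔_; mk↔ₛ′; mk⇔; module Inverse; module Equivalence)
open import Function.Construct.Composition using (_↔-∘_)
open import Relation.Binary.Definitions using (tri<; tri≈; tri>)
open import Relation.Binary.PropositionalEquality
  using (_≡_; _≢_; refl; sym; trans; cong; cong₂; subst; subst₂; module ≡-Reasoning)
open import Relation.Nullary using (¬_; Dec; does; yes; no; contradiction)
open import Relation.Nullary.Decidable using (dec-true; dec-false; does-⇔)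
open import Algebra.Properties.CommutativeMonoid.Sum ℤ.+-0-commutativeMonoid
  using (sum; sum-cong-≗; ∑-distrib-+)
import Algebra.Properties.AbelianGroup ℤ.+-0-abelianGroup as ℤ+

-- Integer order

-- `HasLength` speaks of words only, so the weak order becomes usable once shortest words are
-- matched with a finite count of inversions. Orbits of inversions are indexed by a residue and a
-- gap up to a cutoff `L`. For every `L` the count bounds the length from below; it equals the
-- length once no inversion has a larger gap, and such an `L` exists because displacements are
-- periodic. The relation `≼` reveals only the absence of a covering position, so a descent of `u`
-- yields its `k` under a double negation. This suffices, because the conclusion drawn from it, that
-- two such positions are never adjacent, is itself a negation. Descents are indexed by values of
-- `p`, while adjacency concerns positions. Sums over residues are carried from one to the other by
-- periodic bijections of the integers. In the extremal example, minimality ranges over all `v ≤L p`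
-- in the class, not just over single exchanges; it is settled by comparing inversion sets.

private variable
  x y : ℤ

i<i+1 : ∀ i → i < i + 1ℤ
i<i+1 i = ℤ.suc[i]≤j⇒i<j (ℤ.≤-reflexive (ℤ.+-comm 1ℤ i))

<⇒+1≤ : x < y → x + 1ℤ ℤ.≤ y
<⇒+1≤ {x} x<y = ℤ.≤-trans (ℤ.≤-reflexive (ℤ.+-comm x 1ℤ)) (ℤ.i<j⇒suc[i]≤j x<y)

+1-cancel-≤ : x + 1ℤ ℤ.≤ y + 1ℤ → x ℤ.≤ y
+1-cancel-≤ {x} {y} le = subst₂ ℤ._≤_ (lem x) (lem y) (ℤ.+-monoˡ-≤ (- 1ℤ) le)
  where
  lem : ∀ z → z + 1ℤ + - 1ℤ ≡ z
  lem = solve-∀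

<+1⇒≤ : x < y + 1ℤ → x ℤ.≤ y
<+1⇒≤ x<y+1 = +1-cancel-≤ (<⇒+1≤ x<y+1)

i-1+1≡i : ∀ i → i - 1ℤ + 1ℤ ≡ i
i-1+1≡i = solve-∀

i+1-1≡i : ∀ i → i + 1ℤ - 1ℤ ≡ i
i+1-1≡i = solve-∀

pred-of-suc : ∀ y → x ≡ y + 1ℤ → x - 1ℤ ≡ y
pred-of-suc y refl = i+1-1≡i y

i-1<i : ∀ i → i - 1ℤ < i
i-1<i i = subst (i - 1ℤ <_) (i-1+1≡i i) (i<i+1 (i - 1ℤ))

<⇒≤-1 : x < y → x ℤ.≤ y - 1ℤ
<⇒≤-1 {x} {y} x<y = <+1⇒≤ (subst (x <_) (sym (i-1+1≡i y)) x<y)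

+-cancelˡ-≤ : ∀ i → i + x ℤ.≤ i + y → x ℤ.≤ y
+-cancelˡ-≤ {x} {y} i le = subst₂ ℤ._≤_ (lem i x) (lem i y) (ℤ.+-monoʳ-≤ (- i) le)
  where
  lem : ∀ i z → - i + (i + z) ≡ z
  lem = solve-∀

<⇒+suc : x < y → ∃[ d ] y ≡ x + + suc d
<⇒+suc {x} {y} x<y = ℤ.∣ y - (x + 1ℤ) ∣ ,
  trans (lem x y) (cong (λ e → x + (1ℤ + e)) (sym (ℤ.0≤i⇒+∣i∣≡i (ℤ.i≤j⇒0≤j-i (<⇒+1≤ x<y)))))
  where
  lem : ∀ x y → y ≡ x + (1ℤ + (y - (x + 1ℤ)))
  lem = solve-∀

-- Periodicity

module _ {n : ℕ} (w : AffPerm n) where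
  open AffPerm w

  to-injective : to x ≡ to y → x ≡ y
  to-injective eq = trans (sym (strictlyInverseʳ _)) (trans (cong from eq) (strictlyInverseʳ _))

  to-shift : ∀ i q → to (i + q * + n) ≡ to i + q * + n
  to-shift = periodic-* to periodic

  from-shift : ∀ i q → from (i + q * + n) ≡ from i + q * + n
  from-shift = periodic-* from (from-periodic w)

-- Take `f i = i + F i` in `sum-∘`: the contributions of the identity part of `f` cancel and the
-- sums of `F` remain.
sum-∘-invariant : ∀ {n} (F : ℤ → ℤ) → (∀ i → F (i + + n) ≡ F i) → (v : ℤ ↔ ℤ) →
  (∀ i → Inverse.to v (i + + n) ≡ Inverse.to v i + + n) →
  (∀ i → Inverse.from v (i + + n) ≡ Inverse.from v i + + n) →
  sum {n} (λ k → F (Inverse.to v (pos k))) ≡ sum {n} (λ k → F (pos k))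
sum-∘-invariant {n} F F-per v to-per from-per = ℤ+.∙-cancelˡ (V + P) _ _ (begin
  V + P + sum {n} (F ∘ to ∘ pos)        ≡⟨ lem₁ V P (sum {n} (F ∘ to ∘ pos)) ⟩
  V + sum {n} (F ∘ to ∘ pos) + P        ≡⟨ cong (_+ P) (∑-distrib-+ {n} (to ∘ pos) (F ∘ to ∘ pos)) ⟨
  sum {n} (f ∘ to ∘ pos) + P            ≡⟨ sum-∘ {n} f f-per v to-per from-per ⟩
  sum {n} (f ∘ pos) + V                 ≡⟨ cong (_+ V) (∑-distrib-+ {n} pos (F ∘ pos)) ⟩
  P + sum {n} (F ∘ pos) + V             ≡⟨ lem₂ V P (sum {n} (F ∘ pos)) ⟩
  V + P + sum {n} (F ∘ pos)             ∎)
  where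
  open Inverse v
  open ≡-Reasoning
  P = sum {n} pos
  V = sum {n} (to ∘ pos)
  f : ℤ → ℤ
  f i = i + F i
  f-per : ∀ i → f (i + + n) ≡ f i + + n
  f-per i = trans (cong (_+_ (i + + n)) (F-per i)) (lem i (+ n) (F i))
    where
    lem : ∀ a b c → a + b + c ≡ a + c + b
    lem = solve-∀
  lem₁ : ∀ a b c → a + b + c ≡ a + c + b
  lem₁ = solve-∀
  lem₂ : ∀ a b c → b + c + a ≡ a + b + c
  lem₂ = solve-∀

-- A translation is periodic but, for positive `n`, has the wrong sum of values for an `AffPerm`;
-- hence `sum-∘-invariant` is stated for periodic bijections.
predℤ : ℤ ↔ ℤ
predℤ = mk↔ₛ′ (_- 1ℤ) (_+ 1ℤ) i+1-1≡i i-1+1≡i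

+-swapʳ : ∀ a b c → a + b + c ≡ a + c + b
+-swapʳ = solve-∀

⟦_⟧ : Bool → ℤ
⟦ true  ⟧ = 1ℤ
⟦ false ⟧ = 0ℤ

sum-rotate : ∀ {n} (χ : ℤ → Bool) → (∀ i → χ (i + + n) ≡ χ i) →
  sum {n} (λ k → ⟦ χ (pos k - 1ℤ) ⟧) ≡ sum {n} (λ k → ⟦ χ (pos k) ⟧)
sum-rotate {n} χ per = sum-∘-invariant {n} (⟦_⟧ ∘ χ) (cong ⟦_⟧ ∘ per) predℤ
  (λ i → +-swapʳ i (+ n) (- 1ℤ)) (λ i → +-swapʳ i (+ n) 1ℤ)

-- Products of disjoint adjacent transpositions

-- `χ` marks the lower member of each exchanged pair. One notion serves both the simple generators,
-- where `χ` is a residue class, and the two products in the extremal example.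
record IsSwap (χ : ℤ → Bool) (s : ℤ → ℤ) : Set where
  field
    up   : ∀ i → χ i ≡ true → s i ≡ i + 1ℤ
    down : ∀ i → χ i ≡ true → s (i + 1ℤ) ≡ i
    fix  : ∀ i → χ i ≡ false → χ (i - 1ℤ) ≡ false → s i ≡ i

module Swap {χ : ℤ → Bool} {s : ℤ → ℤ} (isSwap : IsSwap χ s) where
  open IsSwap isSwap

  down′ : ∀ i → χ (i - 1ℤ) ≡ true → s i ≡ i - 1ℤ
  down′ i χi = trans (cong s (sym (i-1+1≡i i))) (down (i - 1ℤ) χi)

  -- Otherwise `i + 1` would be sent both to `i` and to `i + 2`.
  isolated : ∀ i → χ i ≡ true → χ (i + 1ℤ) ≡ true → ⊥
  isolated i p q = ℤ.<⇒≢ (ℤ.<-trans (i<i+1 i) (i<i+1 (i + 1ℤ))) (trans (sym (down i p)) (up (i + 1ℤ) q))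

  involutive : ∀ i → s (s i) ≡ i
  involutive i with χ i in p | χ (i - 1ℤ) in q
  ... | true  | _     = trans (cong s (up i p)) (down i p)
  ... | false | true  = trans (cong s (down′ i q)) (trans (up (i - 1ℤ) q) (i-1+1≡i i))
  ... | false | false = trans (cong s (fix i p q)) (fix i p q)

  injective : s x ≡ s y → x ≡ y
  injective {x} {y} eq = trans (sym (involutive x)) (trans (cong s eq) (involutive y))

  ≤-stay : ∀ i → χ i ≡ false → s i ℤ.≤ i
  ≤-stay i p with χ (i - 1ℤ) in q
  ... | true  = ℤ.≤-trans (ℤ.≤-reflexive (down′ i q)) (ℤ.<⇒≤ (i-1<i i))
  ... | false = ℤ.≤-reflexive (fix i p q)

  ≥-stay : ∀ i → χ (i - 1ℤ) ≡ false → i ℤ.≤ s i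
  ≥-stay i q with χ i in p
  ... | true  = ℤ.≤-trans (ℤ.<⇒≤ (i<i+1 i)) (ℤ.≤-reflexive (sym (up i p)))
  ... | false = ℤ.≤-reflexive (sym (fix i p q))

  ≤-move : ∀ i → s i ℤ.≤ i + 1ℤ
  ≤-move i with χ i in p
  ... | true  = ℤ.≤-reflexive (up i p)
  ... | false = ℤ.≤-trans (≤-stay i p) (ℤ.<⇒≤ (i<i+1 i))

  ≥-move : ∀ i → i - 1ℤ ℤ.≤ s i
  ≥-move i with χ (i - 1ℤ) in q
  ... | true  = ℤ.≤-reflexive (sym (down′ i q))
  ... | false = ℤ.≤-trans (ℤ.<⇒≤ (i-1<i i)) (≥-stay i q)

  -- Every integer moves by at most one, so at distance two or more the images can at worst collide,
  -- which injectivity excludes; only a marked pair of neighbours is reversed.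
  mono-< : x < y → s x < s y ⊎ (χ x ≡ true × y ≡ x + 1ℤ)
  mono-< {x} {y} x<y with ℤ.<-cmp (x + 1ℤ) y
  ... | tri< x+1<y _ _ = inj₁ (ℤ.≤∧≢⇒<
          (ℤ.≤-trans (≤-move x) (ℤ.≤-trans (<⇒≤-1 x+1<y) (≥-move y)))
          (ℤ.<⇒≢ x<y ∘ injective))
  ... | tri> _ _ y<x+1 = contradiction (ℤ.<-≤-trans x<y (<+1⇒≤ y<x+1)) ℤ.i≮i
  ... | tri≈ _ refl _ with χ x in p
  ...   | true  = inj₂ (refl , refl)
  ...   | false = inj₁ (ℤ.≤-<-trans (≤-stay x p) (ℤ.<-≤-trans (i<i+1 x)
                    (≥-stay (x + 1ℤ) (trans (cong χ (i+1-1≡i x)) p))))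

-- The displacement is `1` at the lower and `- 1` at the upper end of a pair. Being the difference
-- of `χ` and its shift, it sums to zero over a period when `χ` is periodic, whence the sum of
-- values in `swapPerm`.
swap : (ℤ → Bool) → ℤ → ℤ
swap χ i = i + (⟦ χ i ⟧ - ⟦ χ (i - 1ℤ) ⟧)

swap-isSwap : ∀ χ → (∀ i → χ i ≡ true → χ (i + 1ℤ) ≡ true → ⊥) → IsSwap χ (swap χ)
swap-isSwap χ isolated = record { up = up ; down = down ; fix = fix }
  where
  up : ∀ i → χ i ≡ true → swap χ i ≡ i + 1ℤ
  up i p with χ (i - 1ℤ) in q
  ... | true  = ⊥-elim (isolated (i - 1ℤ) q (trans (cong χ (i-1+1≡i i)) p))
  ... | false rewrite p = refl
  down : ∀ i → χ i ≡ true → swap χ (i + 1ℤ) ≡ i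
  down i p with χ (i + 1ℤ) in q
  ... | true  = ⊥-elim (isolated i p q)
  ... | false rewrite i+1-1≡i i | p = i+1-1≡i i
  fix : ∀ i → χ i ≡ false → χ (i - 1ℤ) ≡ false → swap χ i ≡ i
  fix i p q rewrite p | q = ℤ.+-identityʳ i

swapPerm : ∀ {n} χ → (∀ i → χ (i + + n) ≡ χ i) →
  (∀ i → χ i ≡ true → χ (i + 1ℤ) ≡ true → ⊥) → AffPerm n
swapPerm {n} χ per isolated = record
  { perm      = mk↔ₛ′ (swap χ) (swap χ) involutive involutive
  ; periodic  = periodic
  ; sum-value = begin
      sum {n} (swap χ ∘ pos)
        ≡⟨ ∑-distrib-+ {n} pos _ ⟩
      P + sum {n} (λ k → ⟦ χ (pos k) ⟧ - ⟦ χ (pos k - 1ℤ) ⟧)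
        ≡⟨ cong (_+_ P) (ℤ+.∙-cancelʳ R _ _ (begin
             sum {n} (λ k → ⟦ χ (pos k) ⟧ - ⟦ χ (pos k - 1ℤ) ⟧) + R
               ≡⟨ ∑-distrib-+ {n} (λ k → ⟦ χ (pos k) ⟧ - ⟦ χ (pos k - 1ℤ) ⟧) _ ⟨
             sum {n} (λ k → ⟦ χ (pos k) ⟧ - ⟦ χ (pos k - 1ℤ) ⟧ + ⟦ χ (pos k - 1ℤ) ⟧)
               ≡⟨ sum-cong-≗ {n} (λ k → lem ⟦ χ (pos k) ⟧ ⟦ χ (pos k - 1ℤ) ⟧) ⟩
             sum {n} (λ k → ⟦ χ (pos k) ⟧)
               ≡⟨ sum-rotate χ per ⟨
             R
               ≡⟨ ℤ.+-identityˡ R ⟨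
             0ℤ + R ∎)) ⟩
      P + 0ℤ
        ≡⟨ ℤ.+-identityʳ P ⟩
      P
        ≡⟨ sum-pos n ⟩
      + (suc n C 2) ∎
  }
  where
  open Swap (swap-isSwap χ isolated)
  open ≡-Reasoning
  open import Data.Nat.Combinatorics using (_C_)
  P = sum {n} pos
  R = sum {n} (λ k → ⟦ χ (pos k - 1ℤ) ⟧)
  lem : ∀ a b → a - b + b ≡ a
  lem = solve-∀
  periodic : ∀ i → swap χ (i + + n) ≡ swap χ i + + n
  periodic i = begin
    i + + n + (⟦ χ (i + + n) ⟧ - ⟦ χ (i + + n - 1ℤ) ⟧)
      ≡⟨ cong₂ (λ p q → i + + n + (⟦ p ⟧ - ⟦ q ⟧)) (per i)
           (trans (cong χ (+-swapʳ i (+ n) (- 1ℤ))) (per (i - 1ℤ))) ⟩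
    i + + n + (⟦ χ i ⟧ - ⟦ χ (i - 1ℤ) ⟧)
      ≡⟨ +-swapʳ i (+ n) _ ⟩
    swap χ i + + n ∎

-- Simple generators

module _ {n : ℕ} .{{_ : NonZero n}} where

  at : Fin n → ℤ → Bool
  at i x = does (residue x Fin.≟ i)

  residue-orbit : ∀ i m → residue (pos i + m * + n) ≡ i
  residue-orbit i m = sym (pos-unique i (residue j) m (quot {n} j) (residue-quot j))
    where j = pos i + m * + n

  residue-shift : ∀ j m → residue {n} (j + m * + n) ≡ residue j
  residue-shift j m = trans
    (cong residue (trans (cong (_+ m * + n) (residue-quot j))
                         (lem (pos (residue {n} j)) (quot {n} j) m (+ n))))
    (residue-orbit (residue j) (quot {n} j + m))
    where
    lem : ∀ r q m N → r + q * N + m * N ≡ r + (q + m) * N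
    lem = solve-∀

  residue-periodic : ∀ j → residue {n} (j + + n) ≡ residue j
  residue-periodic j = trans (cong (λ N → residue (j + N)) (sym (ℤ.*-identityˡ (+ n)))) (residue-shift j 1ℤ)

  at-orbit : ∀ i m → at i (pos i + m * + n) ≡ true
  at-orbit i m = dec-true (_ Fin.≟ i) (residue-orbit i m)

  at-residue : ∀ j → at (residue j) j ≡ true
  at-residue j = dec-true (residue j Fin.≟ residue j) refl

  at⇒orbit : ∀ i j → at i j ≡ true → j ≡ pos i + quot {n} j * + n
  at⇒orbit i j eq with yes refl ← residue j Fin.≟ i = residue-quot j

  at⇒shift : ∀ i x y → at i x ≡ true → at i y ≡ true → ∃[ m ] y ≡ x + m * + n
  at⇒shift i x y p q = quot {n} y - quot {n} x , (begin
    y                                                               ≡⟨ at⇒orbit i y q ⟩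
    pos i + quot {n} y * + n                                        ≡⟨ lem (pos i) (quot {n} x) (quot {n} y) (+ n) ⟩
    pos i + quot {n} x * + n + (quot {n} y - quot {n} x) * + n      ≡⟨ cong (_+ (quot {n} y - quot {n} x) * + n) (at⇒orbit i x p) ⟨
    x + (quot {n} y - quot {n} x) * + n                             ∎)
    where
    open ≡-Reasoning
    lem : ∀ i x y N → i + y * N ≡ i + x * N + (y - x) * N
    lem = solve-∀

  -- Neighbours in one residue class would make `n` divide 1.
  at-isolated : 2 ≤ n → ∀ i j → at i j ≡ true → at i (j + 1ℤ) ≡ true → ⊥
  at-isolated 2≤n i j p q with m , eq ← at⇒shift i j (j + 1ℤ) p q =
    ℕ.<⇒≢ 2≤n (sym (ℕ.m*n≡1⇒n≡1 ℤ.∣ m ∣ n (trans (sym (ℤ.abs-* m (+ n)))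
      (cong ℤ.∣_∣ (sym (ℤ+.∙-cancelˡ j 1ℤ (m * + n) eq))))))

  generator⇒isSwap : ∀ {i} {s : AffPerm n} → IsGenerator i s → IsSwap (at i) (s ⟨_⟩)
  generator⇒isSwap {i} {s} (moves , fixes) = record
    { up   = λ j p → subst (λ z → s ⟨ z ⟩ ≡ z + 1ℤ) (sym (at⇒orbit i j p)) (proj₁ (moves (quot {n} j)))
    ; down = λ j p → subst (λ z → s ⟨ z + 1ℤ ⟩ ≡ z) (sym (at⇒orbit i j p)) (proj₂ (moves (quot {n} j)))
    ; fix  = λ j p q → fixes j λ m →
        (λ eq → absurd p (trans (cong (at i) eq) (at-orbit i m))) ,
        (λ eq → absurd q (trans (cong (at i) (pred-of-suc (pos i + m * + n) eq)) (at-orbit i m)))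
    }
    where
    absurd : ∀ {b} → b ≡ false → b ≡ true → ⊥
    absurd refl ()

  isSwap⇒generator : ∀ {i} {s : AffPerm n} → IsSwap (at i) (s ⟨_⟩) → IsGenerator i s
  isSwap⇒generator {i} {s} isSwap =
    (λ m → up _ (at-orbit i m) , down _ (at-orbit i m)) ,
    (λ j out → fix j
      (off j λ m eq → proj₁ (out m) eq)
      (off (j - 1ℤ) λ m eq → proj₂ (out m) (trans (sym (i-1+1≡i j)) (cong (_+ 1ℤ) eq))))
    where
    open IsSwap isSwap
    off : ∀ j → (∀ m → j ≢ pos i + m * + n) → at i j ≡ false
    off j out with at i j in p
    ... | true  = ⊥-elim (out (quot {n} j) (at⇒orbit i j p))
    ... | false = refl

  generator : 2 ≤ n → Fin n → Generator {n}
  generator 2≤n i = s , i , isSwap⇒generator {i} {s} (swap-isSwap (at i) (at-isolated 2≤n i))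
    where
    s = swapPerm (at i) (λ j → cong (λ r → does (r Fin.≟ i)) (residue-periodic j)) (at-isolated 2≤n i)

-- Length is the number of inversions modulo n

∈-tabulate⁺ : ∀ {n} (f : Fin n → Bool) {i} → f i ≡ true → i ∈ tabulate f
∈-tabulate⁺ f {i} eq = lookup⇒[]= i _ (trans (lookup∘tabulate f i) eq)

∈-tabulate⁻ : ∀ {n} (f : Fin n → Bool) {i} → i ∈ tabulate f → f i ≡ true
∈-tabulate⁻ f {i} i∈ = trans (sym (lookup∘tabulate f i)) ([]=⇒lookup i∈)

∣p∣≤1+∣q∣ : ∀ {n} (p q : Subset n) → (∀ {i j} → i ∈ p → i ∉ q → j ∈ p → j ∉ q → i ≡ j) →
  ∣ p ∣ ≤ suc ∣ q ∣
∣p∣≤1+∣q∣ []            []            uniq = z≤n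
∣p∣≤1+∣q∣ (inside  ∷ p) (inside  ∷ q) uniq = s≤s (∣p∣≤1+∣q∣ p q λ i i′ j j′ →
  Fin.suc-injective (uniq (there i) (i′ ∘ drop-there) (there j) (j′ ∘ drop-there)))
∣p∣≤1+∣q∣ (outside ∷ p) (inside  ∷ q) uniq = ℕ.m≤n⇒m≤1+n (∣p∣≤1+∣q∣ p q λ i i′ j j′ →
  Fin.suc-injective (uniq (there i) (i′ ∘ drop-there) (there j) (j′ ∘ drop-there)))
∣p∣≤1+∣q∣ (outside ∷ p) (outside ∷ q) uniq = ∣p∣≤1+∣q∣ p q λ i i′ j j′ →
  Fin.suc-injective (uniq (there i) (i′ ∘ drop-there) (there j) (j′ ∘ drop-there))
∣p∣≤1+∣q∣ (inside  ∷ p) (outside ∷ q) uniq = s≤s (p⊆q⇒∣p∣≤∣q∣ λ {i} i∈p →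
  case i ∈? q of λ where
    (yes i∈q) → i∈q
    (no  i∉q) → contradiction (uniq here (λ ()) (there i∈p) (i∉q ∘ drop-there)) λ ())

sum-const : ∀ n c → sum {n} (λ _ → c) ≡ + n * c
sum-const zero    c = refl
sum-const (suc n) c = trans (cong (_+_ c) (sum-const n c)) (lem c (+ n))
  where
  lem : ∀ c n → c + n * c ≡ (1ℤ + n) * c
  lem = solve-∀

module _ {n : ℕ} .{{_ : NonZero n}} where
  open Group (S̃ n) using (_≈_; _∙_; _⁻¹; ε)

  Ascending : AffPerm n → Set
  Ascending w = ∀ (k : Fin n) → ¬ w ⟨ pos k + 1ℤ ⟩ < w ⟨ pos k ⟩

  -- The displacement `D` is weakly increasing, because strictly increasing integers grow by at
  -- least one, and it is periodic, hence constant. The prescribed sum of values makes the constant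
  -- zero.
  ascending⇒ε : ∀ w → Ascending w → w ≈ ε
  ascending⇒ε w asc j = begin
    w ⟨ j ⟩            ≡⟨ ℤ+.∙-cancelʳ (- j) _ _ (trans (D≡0 j) (sym (ℤ.+-inverseʳ j))) ⟩
    j                  ∎
    where
    open ≡-Reasoning
    D : ℤ → ℤ
    D j = w ⟨ j ⟩ - j
    D-shift : ∀ j m → D (j + m * + n) ≡ D j
    D-shift j m = trans (cong (_- (j + m * + n)) (to-shift w j m)) (lem (w ⟨ j ⟩) (m * + n) j)
      where
      lem : ∀ a b c → a + b - (c + b) ≡ a - c
      lem = solve-∀
    D-suc-window : ∀ (k : Fin n) → D (pos k) ℤ.≤ D (pos k + 1ℤ)
    D-suc-window k = subst (D (pos k) ℤ.≤_) (lem (w ⟨ pos k + 1ℤ ⟩) (pos k))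
      (ℤ.+-monoˡ-≤ (- pos k) (<⇒≤-1 (ℤ.≤∧≢⇒< (ℤ.≮⇒≥ (asc k))
        (ℤ.<⇒≢ (i<i+1 (pos k)) ∘ to-injective w))))
      where
      lem : ∀ a b → a - 1ℤ - b ≡ a - (b + 1ℤ)
      lem = solve-∀
    D-suc : ∀ j → D j ℤ.≤ D (j + 1ℤ)
    D-suc j = subst₂ ℤ._≤_
      (trans (sym (D-shift r q)) (cong D (sym (residue-quot j))))
      (trans (sym (D-shift (r + 1ℤ) q)) (cong D (trans (+-swapʳ r 1ℤ (q * + n)) (cong (_+ 1ℤ) (sym (residue-quot j))))))
      (D-suc-window (residue j))
      where
      r = pos (residue {n} j)
      q = quot {n} j
    D-mono : ∀ j m → D j ℤ.≤ D (j + + m)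
    D-mono j zero    = ℤ.≤-reflexive (cong D (sym (ℤ.+-identityʳ j)))
    D-mono j (suc m) = ℤ.≤-trans (D-suc j)
      (ℤ.≤-trans (D-mono (j + 1ℤ) m) (ℤ.≤-reflexive (cong D (ℤ.+-assoc j 1ℤ (+ m)))))
    D-window : ∀ (k : Fin n) → D (pos k) ≡ D 0ℤ
    D-window k = ℤ.≤-antisym
      (ℤ.≤-trans (D-mono (pos k) (n ℕ.∸ suc (toℕ k)))
        (ℤ.≤-reflexive (trans
          (cong (λ m → D (+ m)) (ℕ.m+[n∸m]≡n (Fin.toℕ<n k)))
          (trans (cong D (lem (+ n))) (D-shift 0ℤ 1ℤ)))))
      (ℤ.≤-trans (D-mono 0ℤ (suc (toℕ k))) (ℤ.≤-reflexive (cong D (ℤ.+-identityˡ (pos k)))))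
      where
      lem : ∀ N → N ≡ 0ℤ + 1ℤ * N
      lem = solve-∀
    D0≡0 : D 0ℤ ≡ 0ℤ
    D0≡0 = ℤ.*-cancelˡ-≡ (+ n) (D 0ℤ) 0ℤ (trans (sym (sum-const n (D 0ℤ)))
      (trans (ℤ+.∙-cancelˡ (sum {n} pos) _ _ (begin
        sum {n} pos + sum {n} (λ _ → D 0ℤ)            ≡⟨ ∑-distrib-+ {n} pos _ ⟨
        sum {n} (λ k → pos k + D 0ℤ)                  ≡⟨ sum-cong-≗ {n} (λ k → trans
                                                           (cong (_+_ (pos k)) (sym (D-window k)))
                                                           (lem (pos k) (w ⟨ pos k ⟩))) ⟩
        sum {n} (λ k → w ⟨ pos k ⟩)                   ≡⟨ trans (AffPerm.sum-value w) (sym (sum-pos n)) ⟩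
        sum {n} pos                                   ≡⟨ ℤ.+-identityʳ _ ⟨
        sum {n} pos + 0ℤ                              ∎)) (sym (ℤ.*-zeroʳ (+ n)))))
      where
      lem : ∀ a b → a + (b - a) ≡ b
      lem = solve-∀
    D≡0 : ∀ j → D j ≡ 0ℤ
    D≡0 j = trans (cong D (residue-quot {n} j))
      (trans (D-shift (pos (residue {n} j)) (quot {n} j)) (trans (D-window (residue j)) D0≡0))

  -- The pair (k , d) stands for the orbit of the pair of positions k < k + d + 1.
  module _ {L : ℕ} where
    first second : Fin (n ℕ.* L) → ℤ
    first  q = pos (proj₁ (remQuot {n} L q))
    second q = first q + + suc (toℕ (proj₂ (remQuot {n} L q)))

    first<second : ∀ q → first q < second q
    first<second q = subst (_< second q) (ℤ.+-identityʳ (first q))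
      (ℤ.+-monoʳ-< (first q) (ℤ.+<+ ℕ.z<s))

    first-combine : ∀ k d → first (combine k d) ≡ pos k
    first-combine k d = cong (pos ∘ proj₁) (Fin.remQuot-combine k d)

    second-combine : ∀ k d → second (combine k d) ≡ pos k + + suc (toℕ d)
    second-combine k d = cong (λ (k , d) → pos k + + suc (toℕ d)) (Fin.remQuot-combine k d)

    -- So each orbit under translation by `n` is counted once: the residue determines `k`, and then
    -- the gap determines `d`.
    pair-unique : ∀ q q′ m → first q′ ≡ first q + m * + n → second q′ ≡ second q + m * + n → q ≡ q′
    pair-unique q q′ m eq₁ eq₂ = begin
      q                                       ≡⟨ Fin.combine-remQuot {n} L q ⟨
      combine (proj₁ kd) (proj₂ kd)           ≡⟨ cong₂ combine k≡k′ d≡d′ ⟩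
      combine (proj₁ kd′) (proj₂ kd′)         ≡⟨ Fin.combine-remQuot {n} L q′ ⟩
      q′                                      ∎
      where
      open ≡-Reasoning
      kd  = remQuot {n} L q
      kd′ = remQuot {n} L q′
      k≡k′ : proj₁ kd ≡ proj₁ kd′
      k≡k′ = pos-unique (proj₁ kd) (proj₁ kd′) m 0ℤ (sym (trans (ℤ.+-identityʳ _) eq₁))
      d≡d′ : proj₂ kd ≡ proj₂ kd′
      d≡d′ = Fin.toℕ-injective (ℕ.suc-injective (ℤ.+-injective (ℤ+.∙-cancelˡ (first q′) _ _ (begin
        first q′ + + suc (toℕ (proj₂ kd))               ≡⟨ cong (_+ + suc (toℕ (proj₂ kd))) eq₁ ⟩
        first q + m * + n + + suc (toℕ (proj₂ kd))      ≡⟨ +-swapʳ (first q) (m * + n) _ ⟩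
        second q + m * + n                              ≡⟨ eq₂ ⟨
        second q′                                       ∎))))

  -- Only gaps from 1 to `L` are inspected, which keeps the index set finite; under
  -- `BoundedInversions w L` no orbit is missed.
  inversions : AffPerm n → (L : ℕ) → Subset (n ℕ.* L)
  inversions w L = tabulate λ q → does (w ⟨ second q ⟩ ℤ.<? w ⟨ first q ⟩)

  module _ (w : AffPerm n) {L : ℕ} {q : Fin (n ℕ.* L)} where
    inversion⁺ : w ⟨ second q ⟩ < w ⟨ first q ⟩ → q ∈ inversions w L
    inversion⁺ lt = ∈-tabulate⁺ _ (dec-true (_ ℤ.<? _) lt)

    inversion⁻ : q ∈ inversions w L → w ⟨ second q ⟩ < w ⟨ first q ⟩
    inversion⁻ q∈ with ∈-tabulate⁻ (λ q → does (w ⟨ second q ⟩ ℤ.<? w ⟨ first q ⟩)) q∈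
    ... | eq with yes lt ← w ⟨ second q ⟩ ℤ.<? w ⟨ first q ⟩ = lt

  BoundedInversions : AffPerm n → ℕ → Set
  BoundedInversions w L = ∀ x y → x < y → w ⟨ y ⟩ < w ⟨ x ⟩ → y ℤ.≤ x + + L

  module _ {i : Fin n} {s : ℤ → ℤ} (isSwap : IsSwap (at i) s)
           (w w′ : AffPerm n) (w′≗sw : ∀ x → w′ ⟨ x ⟩ ≡ s (w ⟨ x ⟩)) where
    open Swap isSwap
    open AffPerm w

    -- An inversion can be lost only where the two values are `J + 1` and `J` with `J` in the class
    -- of `i`, and all such pairs of positions form a single orbit.
    ∣inversions∣≤1+ : ∀ L → ∣ inversions w L ∣ ≤ suc ∣ inversions w′ L ∣
    ∣inversions∣≤1+ L = ∣p∣≤1+∣q∣ _ _ unique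
      where
      removed : ∀ {q} → q ∈ inversions w L → q ∉ inversions w′ L →
                at i (to (second q)) ≡ true × to (first q) ≡ to (second q) + 1ℤ
      removed {q} q∈ q∉ with mono-< (inversion⁻ w q∈)
      ... | inj₁ lt = contradiction (inversion⁺ w′ (subst₂ _<_ (sym (w′≗sw _)) (sym (w′≗sw _)) lt)) q∉
      ... | inj₂ eq = eq
      unique : ∀ {q q′} → q ∈ inversions w L → q ∉ inversions w′ L →
               q′ ∈ inversions w L → q′ ∉ inversions w′ L → q ≡ q′
      unique {q} {q′} q∈ q∉ q′∈ q′∉
        with at-y , x≡y+1 ← removed q∈ q∉ | at-y′ , x′≡y′+1 ← removed q′∈ q′∉
        with m , eq ← at⇒shift i (to (second q)) (to (second q′)) at-y at-y′ =
        pair-unique q q′ m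
          (to-injective w (begin
            to (first q′)                       ≡⟨ x′≡y′+1 ⟩
            to (second q′) + 1ℤ                 ≡⟨ cong (_+ 1ℤ) eq ⟩
            to (second q) + m * + n + 1ℤ        ≡⟨ +-swapʳ (to (second q)) (m * + n) 1ℤ ⟩
            to (second q) + 1ℤ + m * + n        ≡⟨ cong (_+ m * + n) x≡y+1 ⟨
            to (first q) + m * + n              ≡⟨ to-shift w (first q) m ⟨
            to (first q + m * + n)              ∎))
          (to-injective w (trans eq (sym (to-shift w (second q) m))))
        where open ≡-Reasoning

    module _ {j : ℤ} (at-j : at i j ≡ true) (descent : from (j + 1ℤ) < from j) where

      -- A new inversion would need values `J`, `J + 1` in increasing order of position, with `J` a
      -- translate of `j`; the translated `descent` says the opposite.
      inversion-before : x < y → w′ ⟨ y ⟩ < w′ ⟨ x ⟩ → w ⟨ y ⟩ < w ⟨ x ⟩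
      inversion-before {x} {y} x<y inv with ℤ.<-cmp (w ⟨ x ⟩) (w ⟨ y ⟩)
      ... | tri> _ _ gt = gt
      ... | tri≈ _ eq _ = contradiction (to-injective w eq) (ℤ.<⇒≢ x<y)
      ... | tri< lt _ _ with mono-< lt
      ...   | inj₁ lt′ = contradiction (subst₂ _<_ (sym (w′≗sw x)) (sym (w′≗sw y)) lt′) (ℤ.<-asym inv)
      ...   | inj₂ (at-x , y≡x+1) with m , eq ← at⇒shift i j (w ⟨ x ⟩) at-j at-x =
        contradiction x<y (ℤ.<-asym (subst₂ _<_
          (trans (sym (from-shift w (j + 1ℤ) m)) (trans (cong from
            (trans (+-swapʳ j 1ℤ (m * + n)) (trans (cong (_+ 1ℤ) (sym eq)) (sym y≡x+1)))) (strictlyInverseʳ y)))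
          (trans (sym (from-shift w j m)) (trans (cong from (sym eq)) (strictlyInverseʳ x)))
          (ℤ.+-monoˡ-< (m * + n) descent)))

      boundedInversions-swap : ∀ {L} → BoundedInversions w L → BoundedInversions w′ L
      boundedInversions-swap bounded x y x<y inv = bounded x y x<y (inversion-before x<y inv)

      ∣inversions∣-< : ∀ {L} → BoundedInversions w L → ∣ inversions w′ L ∣ ℕ.< ∣ inversions w L ∣
      ∣inversions∣-< {L} bounded = p⊂q⇒∣p∣<∣q∣
        ( (λ {q} q∈ → inversion⁺ w (inversion-before (first<second q) (inversion⁻ w′ q∈)))
        , q
        , inversion⁺ w (subst₂ _<_ (sym w-second) (sym w-first) (i<i+1 J))
        , λ q∈ → ℤ.<-asym (inversion⁻ w′ q∈) (subst₂ _<_ (sym w′-first) (sym w′-second) (i<i+1 J)))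
        where
        open ≡-Reasoning
        open IsSwap isSwap
        b = from (j + 1ℤ)
        -- Translating by `- t` periods brings the position of `j + 1` into the window from 1 to
        -- `n`, where `first` takes its values.
        t = quot {n} b
        J = j + - t * + n
        gap = <⇒+suc descent
        d = proj₁ gap
        -- The cutoff matters here: the pair of positions that loses its inversion must itself be
        -- indexed.
        d<L : d ℕ.< L
        d<L = ℤ.drop‿+≤+ (+-cancelˡ-≤ b (ℤ.≤-trans (ℤ.≤-reflexive (sym (proj₂ gap)))
          (bounded b (from j) descent (subst₂ _<_ (sym (strictlyInverseˡ j)) (sym (strictlyInverseˡ (j + 1ℤ))) (i<i+1 j)))))
        q : Fin (n ℕ.* L)
        q = combine (residue b) (fromℕ< d<L)
        first-q : first q ≡ b + - t * + n
        first-q = trans (first-combine (residue b) (fromℕ< d<L))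
          (trans (lem (pos (residue b)) t (+ n)) (cong (_+ - t * + n) (sym (residue-quot b))))
          where
          lem : ∀ r t N → r ≡ r + t * N + - t * N
          lem = solve-∀
        second-q : second q ≡ from j + - t * + n
        second-q = begin
          second q                                   ≡⟨ second-combine (residue b) (fromℕ< d<L) ⟩
          pos (residue b) + + suc (toℕ (fromℕ< d<L)) ≡⟨ cong (λ e → pos (residue b) + + suc e) (Fin.toℕ-fromℕ< d<L) ⟩
          pos (residue b) + + suc d                  ≡⟨ cong (_+ + suc d) (trans (sym (first-combine (residue b) (fromℕ< d<L))) first-q) ⟩
          b + - t * + n + + suc d                    ≡⟨ +-swapʳ b (- t * + n) (+ suc d) ⟩
          b + + suc d + - t * + n                    ≡⟨ cong (_+ - t * + n) (proj₂ gap) ⟨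
          from j + - t * + n                         ∎
        w-first : to (first q) ≡ J + 1ℤ
        w-first = trans (cong to first-q) (trans (to-shift w b (- t))
          (trans (cong (_+ - t * + n) (strictlyInverseˡ (j + 1ℤ))) (+-swapʳ j 1ℤ (- t * + n))))
        w-second : to (second q) ≡ J
        w-second = trans (cong to second-q) (trans (to-shift w (from j) (- t))
          (cong (_+ - t * + n) (strictlyInverseˡ j)))
        at-J : at i J ≡ true
        at-J = trans (cong (λ r → does (r Fin.≟ i)) (residue-shift j (- t))) at-j
        w′-first : w′ ⟨ first q ⟩ ≡ J
        w′-first = trans (w′≗sw (first q)) (trans (cong s w-first) (down J at-J))
        w′-second : w′ ⟨ second q ⟩ ≡ J + 1ℤ
        w′-second = trans (w′≗sw (second q)) (trans (cong s w-second) (up J at-J))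

  -- The identity has no inversions and each letter adds at most one, whatever the cutoff.
  ∣inversions∣≤length : ∀ {k} w (ss : Vec Generator k) → IsWordFor w ss → ∀ L → ∣ inversions w L ∣ ≤ k
  ∣inversions∣≤length w [] ε≈w L = ℕ.≤-trans
    (p⊆q⇒∣p∣≤∣q∣ {p = inversions w L} {∅} λ {q} q∈ → contradiction
      (subst₂ _<_ (sym (ε≈w (second q))) (sym (ε≈w (first q))) (inversion⁻ w q∈))
      (ℤ.<-asym (first<second q)))
    (ℕ.≤-reflexive (∣⊥∣≡0 (n ℕ.* L)))
  ∣inversions∣≤length w ((s , i , gen) ∷ ss) s∙v≈w L = ℕ.≤-trans
    -- The exchange is read backwards: `s` is an involution, so it takes `w` to `v`.
    (∣inversions∣≤1+ isSwap w v (λ x → trans (sym (involutive (v ⟨ x ⟩))) (cong (s ⟨_⟩) (s∙v≈w x))) L)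
    (s≤s (∣inversions∣≤length v ss (λ _ → refl) L))
    where
    v = foldr′ (λ s x → proj₁ s ∙ x) ε ss
    isSwap = generator⇒isSwap {n} {i} {s} gen
    open Swap isSwap

-- For `n = 1` periodicity gives `from (j + 1) = from j + 1`, so nothing descends.
descent⇒2≤n : ∀ {n} .{{_ : NonZero n}} (w : AffPerm n) → ∀ j →
  AffPerm.from w (j + 1ℤ) < AffPerm.from w j → 2 ≤ n
descent⇒2≤n {suc zero}    w j lt = contradiction
  (subst (_< AffPerm.from w j) (from-periodic w j) lt) (ℤ.<-asym (i<i+1 _))
descent⇒2≤n {suc (suc n)} w j lt = s≤s (s≤s z≤n)

upperBound : ∀ {n} (f : Fin n → ℕ) → ∃[ C ] ∀ k → f k ≤ C
upperBound {zero}  f = 0 , λ ()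
upperBound {suc n} f with C , f≤C ← upperBound (f ∘ suc) = f zero ℕ.⊔ C , λ where
  zero    → ℕ.m≤m⊔n (f zero) C
  (suc k) → ℕ.≤-trans (f≤C k) (ℕ.m≤n⊔m (f zero) C)

i≤∣i∣ : ∀ i → i ℤ.≤ + ℤ.∣ i ∣
i≤∣i∣ (+ _)      = ℤ.≤-refl
i≤∣i∣ ℤ.-[1+ _ ] = ℤ.-≤+

-- Reduced words

module _ {n : ℕ} .{{_ : NonZero n}} where
  open Group (S̃ n) using (_≈_; _∙_; _⁻¹; ε)

  NoDescent : AffPerm n → Set
  NoDescent w = ∀ (k : Fin n) → ¬ AffPerm.from w (pos k + 1ℤ) < AffPerm.from w (pos k)

  noDescent⇒ε : ∀ w → NoDescent w → ε ≈ w
  noDescent⇒ε w none j = trans (sym (strictlyInverseˡ j)) (cong to (ascending⇒ε (w ⁻¹) none j))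
    where open AffPerm w

  word-∷ : ∀ {ℓ} (g : Generator) (w : AffPerm n) → ∃[ ss ] IsWordFor {k = ℓ} (proj₁ g ∙ w) ss →
           ∃[ ss ] IsWordFor {k = suc ℓ} w ss
  word-∷ g@(s , i , gen) w (ss , eq) =
    g ∷ ss , λ j → trans (cong (s ⟨_⟩) (eq j)) (Swap.involutive (generator⇒isSwap {n} {i} {s} gen) (w ⟨ j ⟩))

  -- Bubble sort on values: while some `j + 1` stands before `j`, exchanging them removes exactly
  -- one inversion orbit and creates none, so the same `L` serves throughout. Without such a `j`
  -- only the identity is left.
  word : ∀ L ℓ (w : AffPerm n) → BoundedInversions w L → ∣ inversions w L ∣ ≡ ℓ →
         ∃[ ss ] IsWordFor {k = ℓ} w ss
  word L ℓ w bounded eq = byCases (Fin.any? (λ k → from (pos k + 1ℤ) ℤ.<? from (pos k)))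
    where
    open AffPerm w
    byCases : Dec (∃[ k ] from (pos {n} k + 1ℤ) < from (pos k)) → ∃[ ss ] IsWordFor {k = ℓ} w ss
    byCases (no ¬descent) = subst (λ ℓ → ∃[ ss ] IsWordFor {k = ℓ} w ss)
      (trans (sym (ℕ.n≤0⇒n≡0 (∣inversions∣≤length w [] w≈ε L))) eq) ([] , w≈ε)
      where
      w≈ε : ε ≈ w
      w≈ε = noDescent⇒ε w (λ k lt → ¬descent (k , lt))
    byCases (yes (k , descent)) = reduce ℓ eq (generator (descent⇒2≤n w (pos k) descent) k) refl
      where
      at-k : at k (pos k) ≡ true
      at-k = trans (cong (at k) (sym (ℤ.+-identityʳ (pos k)))) (at-orbit k 0ℤ)
      -- The generator is taken as a variable, so that the recursion sees its property `gen` and not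
      -- the formula for `swap`.
      reduce : ∀ ℓ → ∣ inversions w L ∣ ≡ ℓ → (g : Generator) → proj₁ (proj₂ g) ≡ k →
               ∃[ ss ] IsWordFor {k = ℓ} w ss
      reduce ℓ eq g@(s , _ , gen) refl = go ℓ eq
        where
        isSwap : IsSwap (at k) (s ⟨_⟩)
        isSwap = generator⇒isSwap {n} {k} {s} gen
        shorter : ∣ inversions (s ∙ w) L ∣ ℕ.< ∣ inversions w L ∣
        shorter = ∣inversions∣-< isSwap w (s ∙ w) (λ _ → refl) at-k descent bounded
        go : ∀ ℓ → ∣ inversions w L ∣ ≡ ℓ → ∃[ ss ] IsWordFor {k = ℓ} w ss
        go zero    eq = contradiction (subst (∣ inversions (s ∙ w) L ∣ ℕ.<_) eq shorter) ℕ.n≮0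
        go (suc ℓ) eq = word-∷ g w (word L ℓ (s ∙ w)
          (boundedInversions-swap isSwap w (s ∙ w) (λ _ → refl) at-k descent bounded)
          (ℕ.suc-injective (trans (ℕ.≤-antisym shorter (∣inversions∣≤1+ isSwap w (s ∙ w) (λ _ → refl) L)) eq)))

  hasLength : ∀ L (w : AffPerm n) → BoundedInversions w L → HasLength w ∣ inversions w L ∣
  hasLength L w bounded = word L _ w bounded refl , λ m ss eq → ∣inversions∣≤length w ss eq L

  -- Displacements are periodic, hence bounded by some `C` in absolute value; two positions whose
  -- values are inverted are then at most `2C` apart.
  ∃-boundedInversions : ∀ (w : AffPerm n) → ∃[ L ] BoundedInversions w L
  ∃-boundedInversions w with C , ≤C ← upperBound (λ (k : Fin n) → ℤ.∣ w ⟨ pos k ⟩ - pos k ∣) =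
    C ℕ.+ C , λ x y _ inv → begin
      y                       ≡⟨ lem₁ y (w ⟨ y ⟩) ⟩
      w ⟨ y ⟩ + - (D y)       ≤⟨ ℤ.+-mono-≤ (ℤ.<⇒≤ inv) (≤∣D∣ y (ℤ.≤-trans (i≤∣i∣ (- D y)) (ℤ.≤-reflexive (cong +_ (ℤ.∣-i∣≡∣i∣ (D y)))))) ⟩
      w ⟨ x ⟩ + + C           ≡⟨ lem₂ x (w ⟨ x ⟩) (+ C) ⟩
      x + (D x + + C)         ≤⟨ ℤ.+-monoʳ-≤ x (ℤ.+-monoˡ-≤ (+ C) (≤∣D∣ x (i≤∣i∣ (D x)))) ⟩
      x + + (C ℕ.+ C)         ∎
    where
    open ℤ.≤-Reasoning
    D : ℤ → ℤ
    D x = w ⟨ x ⟩ - x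
    D-residue : ∀ x → D x ≡ D (pos (residue {n} x))
    D-residue x = trans (cong D (residue-quot {n} x)) (trans
      (cong (_- (r + q * + n)) (to-shift w r q)) (lem (w ⟨ r ⟩) r (q * + n)))
      where
      r = pos (residue {n} x)
      q = quot {n} x
      lem : ∀ a b c → a + c - (b + c) ≡ a - b
      lem = solve-∀
    ≤∣D∣ : ∀ {z} x → z ℤ.≤ + ℤ.∣ D x ∣ → z ℤ.≤ + C
    ≤∣D∣ x z≤ = ℤ.≤-trans z≤ (ℤ.+≤+ (subst (λ d → ℤ.∣ d ∣ ≤ C) (sym (D-residue x)) (≤C (residue x))))
    lem₁ : ∀ y v → y ≡ v + - (v - y)
    lem₁ = solve-∀
    lem₂ : ∀ x v C → v + C ≡ x + (v - x + C)
    lem₂ = solve-∀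

-- The sylvester congruence

⊔-lub-< : ∀ {z} → x < z → y < z → x ⊔ y < z
⊔-lub-< {x} {y} {z} x<z y<z with ℤ.⊔-sel x y
... | inj₁ eq = subst (_< z) (sym eq) x<z
... | inj₂ eq = subst (_< z) (sym eq) y<z

Between : ℤ → ℤ → ℤ → Set
Between x k y = (x < k × k < y) ⊎ (y < k × k < x)

between-sym : ∀ {k} → Between x k y → Between y k x
between-sym (inj₁ b) = inj₂ b
between-sym (inj₂ b) = inj₁ b

between-trans : ∀ {k l} → Between x k y → Between x l k → Between x l y
between-trans (inj₁ (x<k , k<y)) (inj₁ (x<l , l<k)) = inj₁ (x<l , ℤ.<-trans l<k k<y)
between-trans (inj₁ (x<k , k<y)) (inj₂ (k<l , l<x)) = contradiction (ℤ.<-trans k<l l<x) (ℤ.<-asym x<k)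
between-trans (inj₂ (y<k , k<x)) (inj₁ (x<l , l<k)) = contradiction (ℤ.<-trans x<l l<k) (ℤ.<-asym k<x)
between-trans (inj₂ (y<k , k<x)) (inj₂ (k<l , l<x)) = inj₂ (ℤ.<-trans y<k k<l , l<x)

module _ {n : ℕ} where

  -- A symmetric form of `Incomparable`, with the witness exposed so that two permutations can share
  -- it.
  Covers : AffPerm n → ℤ → ℤ → ℤ → Set
  Covers w k x y = Between x k y × w ⟨ x ⟩ < w ⟨ k ⟩ × w ⟨ y ⟩ < w ⟨ k ⟩

  incomparable⇒covers : ∀ w x y → Incomparable w (x ⊓ y) (x ⊔ y) → ∃[ k ] Covers w k x y
  incomparable⇒covers w x y (k , lo , hi , top) with ℤ.≤-total x y
  ... | inj₁ x≤y rewrite ℤ.i≤j⇒i⊓j≡i x≤y | ℤ.i≤j⇒i⊔j≡j x≤y =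
    k , inj₁ (lo , hi) , ℤ.≤-<-trans (ℤ.i≤i⊔j _ _) top , ℤ.≤-<-trans (ℤ.i≤j⊔i _ _) top
  ... | inj₂ y≤x rewrite ℤ.i≥j⇒i⊓j≡j y≤x | ℤ.i≥j⇒i⊔j≡i y≤x =
    k , inj₂ (lo , hi) , ℤ.≤-<-trans (ℤ.i≤j⊔i _ _) top , ℤ.≤-<-trans (ℤ.i≤i⊔j _ _) top

  covers⇒incomparable : ∀ w x y {k} → Covers w k x y → Incomparable w (x ⊓ y) (x ⊔ y)
  covers⇒incomparable w x y {k} (inj₁ (x<k , k<y) , x<ᵂk , y<ᵂk)
    rewrite ℤ.i≤j⇒i⊓j≡i (ℤ.<⇒≤ (ℤ.<-trans x<k k<y)) | ℤ.i≤j⇒i⊔j≡j (ℤ.<⇒≤ (ℤ.<-trans x<k k<y)) =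
    k , x<k , k<y , ⊔-lub-< x<ᵂk y<ᵂk
  covers⇒incomparable w x y {k} (inj₂ (y<k , k<x) , x<ᵂk , y<ᵂk)
    rewrite ℤ.i≥j⇒i⊓j≡j (ℤ.<⇒≤ (ℤ.<-trans y<k k<x)) | ℤ.i≥j⇒i⊔j≡i (ℤ.<⇒≤ (ℤ.<-trans y<k k<x)) =
    k , y<k , k<x , ⊔-lub-< y<ᵂk x<ᵂk

  -- A criterion for `≡syl` suited to exchanges: an order may change only at pairs covered in both
  -- permutations by a common position.
  Refines : AffPerm n → AffPerm n → Set
  Refines p v = ∀ x y → p ⟨ x ⟩ < p ⟨ y ⟩ →
    v ⟨ x ⟩ < v ⟨ y ⟩ ⊎ ∃[ k ] Covers p k x y × Covers v k x y

  -- If `k` covers `x` and `y` in `v`, pulling its two comparisons back to `p` either keeps them or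
  -- supplies covers `l`, `l′` still between `x` and `y`. The highest in `p` of the positions so
  -- obtained covers `x` and `y` in `p`.
  refines⇒≼ : ∀ {p v} → Refines p v → Refines v p → ∀ x y → p [ x ≼ y ] → v [ x ≼ y ]
  refines⇒≼ {p} {v} p⊑v v⊑p x y (x≤y , comparable) = vx≤vy , comparable-v ∘ incomparable⇒covers v x y
    where
    uncovered : ∀ {k} → Covers p k x y → ⊥
    uncovered = comparable ∘ covers⇒incomparable p x y
    vx≤vy : v ⟨ x ⟩ ℤ.≤ v ⟨ y ⟩
    vx≤vy with ℤ.<-cmp (p ⟨ x ⟩) (p ⟨ y ⟩)
    ... | tri≈ _ eq _ = ℤ.≤-reflexive (cong (v ⟨_⟩) (to-injective p eq))
    ... | tri> _ _ gt = contradiction (ℤ.≤-<-trans x≤y gt) ℤ.i≮i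
    ... | tri< lt _ _ with p⊑v x y lt
    ...   | inj₁ vx<vy           = ℤ.<⇒≤ vx<vy
    ...   | inj₂ (_ , cover , _) = ⊥-elim (uncovered cover)
    comparable-v : ¬ (∃[ k ] Covers v k x y)
    comparable-v (k , between , vx<vk , vy<vk) with v⊑p x k vx<vk | v⊑p y k vy<vk
    ... | inj₁ px<pk | inj₁ py<pk = uncovered (between , px<pk , py<pk)
    ... | inj₁ px<pk | inj₂ (l , _ , l-between , py<pl , pk<pl) = uncovered
      ( between-sym (between-trans (between-sym between) l-between) , ℤ.<-trans px<pk pk<pl , py<pl)
    ... | inj₂ (l , _ , l-between , px<pl , pk<pl) | inj₁ py<pk = uncovered
      (between-trans between l-between , px<pl , ℤ.<-trans py<pk pk<pl)
    ... | inj₂ (l , _ , l-between , px<pl , _) | inj₂ (l′ , _ , l′-between , py<pl′ , _)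
      with ℤ.≤-total (p ⟨ l ⟩) (p ⟨ l′ ⟩)
    ...   | inj₁ pl≤pl′ = uncovered
      (between-sym (between-trans (between-sym between) l′-between) , ℤ.<-≤-trans px<pl pl≤pl′ , py<pl′)
    ...   | inj₂ pl′≤pl = uncovered
      (between-trans between l-between , px<pl , ℤ.<-≤-trans py<pl′ pl′≤pl)

  refines⇒≡syl : ∀ {p v} → Refines p v → Refines v p → p ≡syl v
  refines⇒≡syl {p} {v} p⊑v v⊑p x y = mk⇔ (refines⇒≼ {p} {v} p⊑v v⊑p x y) (refines⇒≼ {v} {p} v⊑p p⊑v x y)

  ≡syl-sym : {v w : AffPerm n} → v ≡syl w → w ≡syl v
  ≡syl-sym v≡w x y = mk⇔ (Equivalence.from (v≡w x y)) (Equivalence.to (v≡w x y))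

  ≡syl-trans : {u v w : AffPerm n} → u ≡syl v → v ≡syl w → u ≡syl w
  ≡syl-trans u≡v v≡w x y = mk⇔ (Equivalence.to (v≡w x y) ∘ Equivalence.to (u≡v x y))
    (Equivalence.from (u≡v x y) ∘ Equivalence.from (v≡w x y))

-- Exchanging consecutive values

module _ {n : ℕ} .{{_ : NonZero n}} where
  open Group (S̃ n) using (_≈_; _∙_; _⁻¹; ε)

  generator-hasLength : ∀ {i s} {w : AffPerm n} → IsGenerator i s → s ≈ w → HasLength w 1
  generator-hasLength {i} {s} {w} gen s≈w = ((s , i , gen) ∷ [] , s≈w) , nontrivial
    where
    nontrivial : ∀ m (ss : Vec Generator m) → IsWordFor w ss → 1 ≤ m
    nontrivial zero    [] ε≈w = contradiction (trans (sym (proj₁ (proj₁ gen 0ℤ))) (trans (s≈w j) (sym (ε≈w j))))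
      (ℤ.<⇒≢ (i<i+1 j) ∘ sym)
      where j = pos i + 0ℤ * + n
    nontrivial (suc m) _  _   = s≤s z≤n

  -- Here `p ∙ (s ∙ p) ⁻¹` is `s` itself, of length 1, and the inversion count drops by exactly 1.
  generator-≤L : ∀ {i s j} (gen : IsGenerator i s) (p : AffPerm n) →
    at i j ≡ true → AffPerm.from p (j + 1ℤ) < AffPerm.from p j → s ∙ p ≤L p
  generator-≤L {i} {s} {j} gen p at-j descent = below (∃-boundedInversions p)
    where
    open AffPerm p
    isSwap = generator⇒isSwap {n} {i} {s} gen
    from-s : ∀ x → AffPerm.from s x ≡ s ⟨ x ⟩
    from-s x = trans (cong (AffPerm.from s) (sym (Swap.involutive isSwap x))) (AffPerm.strictlyInverseʳ s (s ⟨ x ⟩))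
    lem : ∀ c → 1ℤ ≡ 1ℤ + c - c
    lem = solve-∀
    below : ∃[ L ] BoundedInversions p L → s ∙ p ≤L p
    below (L , bounded) =
      1 , suc c , c ,
      generator-hasLength {i} {s} {p ∙ (s ∙ p) ⁻¹} gen
        (λ x → sym (trans (strictlyInverseˡ (AffPerm.from s x)) (from-s x))) ,
      subst (HasLength p) (ℕ.≤-antisym (∣inversions∣≤1+ isSwap p (s ∙ p) (λ _ → refl) L)
        (∣inversions∣-< isSwap p (s ∙ p) (λ _ → refl) at-j descent bounded)) (hasLength L p bounded) ,
      hasLength L (s ∙ p) (boundedInversions-swap isSwap p (s ∙ p) (λ _ → refl) at-j descent bounded) ,
      lem (+ c)
      where c = ∣ inversions (s ∙ p) L ∣

  -- Only pairs carrying values `J`, `J + 1` with `J` a translate of `j` change order, and the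
  -- matching translate of `k` covers them before and after.
  generator-≡syl : ∀ {i s j k} (gen : IsGenerator i s) (p : AffPerm n) →
    at i j ≡ true → AffPerm.from p (j + 1ℤ) < k → k < AffPerm.from p j → j + 1ℤ < p ⟨ k ⟩ → s ∙ p ≡syl p
  generator-≡syl {i} {s} {j} {k} gen p at-j below above high = refines⇒≡syl {p = s ∙ p} {p} v⊑p p⊑v
    where
    open AffPerm p
    open IsSwap (generator⇒isSwap {n} {i} {s} gen)
    open Swap (generator⇒isSwap {n} {i} {s} gen)
    v : AffPerm n
    v = s ∙ p
    cover : ∀ x y → at i (to x) ≡ true → to y ≡ to x + 1ℤ → ∃[ l ] Covers p l x y × Covers v l x y
    cover x y at-x y≡x+1 with m , eq ← at⇒shift i j (to x) at-j at-x =
      l , (between , x<l , y<l) , (between , vx<vl , vy<vl)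
      where
      l = k + m * + n
      x≡ : x ≡ from j + m * + n
      x≡ = trans (sym (strictlyInverseʳ x)) (trans (cong from eq) (from-shift p j m))
      y≡ : y ≡ from (j + 1ℤ) + m * + n
      y≡ = trans (sym (strictlyInverseʳ y)) (trans (cong from (trans y≡x+1
        (trans (cong (_+ 1ℤ) eq) (+-swapʳ j (m * + n) 1ℤ)))) (from-shift p (j + 1ℤ) m))
      between : Between x l y
      between = inj₂ (subst (_< l) (sym y≡) (ℤ.+-monoˡ-< (m * + n) below) ,
                      subst (l <_) (sym x≡) (ℤ.+-monoˡ-< (m * + n) above))
      y<l : to y < to l
      y<l = subst₂ _<_ (trans (+-swapʳ j 1ℤ (m * + n)) (sym (trans y≡x+1 (cong (_+ 1ℤ) eq))))
              (sym (to-shift p k m)) (ℤ.+-monoˡ-< (m * + n) high)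
      x<y : to x < to y
      x<y = subst (to x <_) (sym y≡x+1) (i<i+1 (to x))
      x<l : to x < to l
      x<l = ℤ.<-trans x<y y<l
      vx≡y : v ⟨ x ⟩ ≡ to y
      vx≡y = trans (up (to x) at-x) (sym y≡x+1)
      vy≡x : v ⟨ y ⟩ ≡ to x
      vy≡x = trans (cong (s ⟨_⟩) y≡x+1) (down (to x) at-x)
      -- The exchange may lower the value at `l` by one, at worst to the new value at `x`;
      -- injectivity excludes the tie.
      vx<vl : v ⟨ x ⟩ < v ⟨ l ⟩
      vx<vl = ℤ.≤∧≢⇒< (ℤ.≤-trans (ℤ.≤-reflexive vx≡y) (ℤ.≤-trans (<⇒≤-1 y<l) (≥-move (to l))))
                (ℤ.<⇒≢ x<l ∘ injective)
      vy<vl : v ⟨ y ⟩ < v ⟨ l ⟩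
      vy<vl = ℤ.<-trans (subst₂ _<_ (sym vy≡x) (sym vx≡y) x<y) vx<vl
    p⊑v : Refines p v
    p⊑v x y x<y with mono-< x<y
    ... | inj₁ vx<vy            = inj₁ vx<vy
    ... | inj₂ (at-x , y≡x+1)   = inj₂ (cover x y at-x y≡x+1)
    swapCover : ∀ {x y} → ∃[ l ] Covers p l x y × Covers v l x y → ∃[ l ] Covers v l y x × Covers p l y x
    swapCover (l , (b , px , py) , (_ , vx , vy)) = l , (between-sym b , vy , vx) , (between-sym b , py , px)
    v⊑p : Refines v p
    v⊑p x y x<y with mono-< x<y
    ... | inj₁ lt = inj₁ (subst₂ _<_ (involutive (to x)) (involutive (to y)) lt)
    ... | inj₂ (at-vx , vy≡vx+1) = inj₂ (swapCover (cover y x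
      (trans (cong (at i) y≡vx) at-vx) (trans x≡vx+1 (cong (_+ 1ℤ) (sym y≡vx)))))
      where
      x≡vx+1 : to x ≡ v ⟨ x ⟩ + 1ℤ
      x≡vx+1 = trans (sym (involutive (to x))) (up (v ⟨ x ⟩) at-vx)
      y≡vx : to y ≡ v ⟨ x ⟩
      y≡vx = trans (sym (involutive (to y))) (trans (cong (s ⟨_⟩) vy≡vx+1) (down (v ⟨ x ⟩) at-vx))

-- Descents of a stack-sorted permutation

+-cancelʳ-< : ∀ c → x + c < y + c → x < y
+-cancelʳ-< {x} {y} c lt = subst₂ _<_ (lem x c) (lem y c) (ℤ.+-monoˡ-< (- c) lt)
  where
  lem : ∀ z c → z + c + - c ≡ z
  lem = solve-∀

∣tabulate∣≡sum : ∀ {n} (f : Fin n → Bool) → + ∣ tabulate f ∣ ≡ sum {n} (λ k → ⟦ f k ⟧)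
∣tabulate∣≡sum {zero}  f = refl
∣tabulate∣≡sum {suc n} f with f zero
... | true  = cong (_+_ 1ℤ) (∣tabulate∣≡sum (f ∘ suc))
... | false = trans (∣tabulate∣≡sum (f ∘ suc)) (sym (ℤ.+-identityˡ _))

sum≤n : ∀ {n} (f : Fin n → ℤ) → (∀ k → f k ℤ.≤ 1ℤ) → sum {n} f ℤ.≤ + n
sum≤n {zero}  f f≤1 = ℤ.≤-refl
sum≤n {suc n} f f≤1 = ℤ.+-mono-≤ (f≤1 zero) (sum≤n (f ∘ suc) (f≤1 ∘ suc))

⟦⟧+⟦⟧≤1 : ∀ b c → (b ≡ true → c ≡ true → ⊥) → ⟦ b ⟧ + ⟦ c ⟧ ℤ.≤ 1ℤ
⟦⟧+⟦⟧≤1 true  true  exclusive = ⊥-elim (exclusive refl refl)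
⟦⟧+⟦⟧≤1 true  false exclusive = ℤ.≤-refl
⟦⟧+⟦⟧≤1 false true  exclusive = ℤ.≤-refl
⟦⟧+⟦⟧≤1 false false exclusive = ℤ.+≤+ z≤n

module _ {n : ℕ} (u : AffPerm n) where

  isDescent : ℤ → Bool
  isDescent j = does (u ⟨ j + 1ℤ ⟩ ℤ.<? u ⟨ j ⟩)

  isDescent⁻ : ∀ j → isDescent j ≡ true → u ⟨ j + 1ℤ ⟩ < u ⟨ j ⟩
  isDescent⁻ j eq with yes lt ← u ⟨ j + 1ℤ ⟩ ℤ.<? u ⟨ j ⟩ = lt

  isDescent-periodic : ∀ j → isDescent (j + + n) ≡ isDescent j
  isDescent-periodic j = does-⇔ (mk⇔
    (λ lt → +-cancelʳ-< {to (j + 1ℤ)} {to j} (+ n) (subst₂ _<_ shift₁ (periodic j) lt))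
    (λ lt → subst₂ _<_ (sym shift₁) (sym (periodic j)) (ℤ.+-monoˡ-< (+ n) lt)))
    (to (j + + n + 1ℤ) ℤ.<? to (j + + n)) (to (j + 1ℤ) ℤ.<? to j)
    where
    open AffPerm u
    shift₁ : to (j + + n + 1ℤ) ≡ to (j + 1ℤ) + + n
    shift₁ = trans (cong to (+-swapʳ j (+ n) 1ℤ)) (periodic (j + 1ℤ))

-- Minimal elements and their descents

module Minimal {n : ℕ} .{{_ : NonZero n}} (w p : AffPerm n) (minimal : IsMinimalInClassOf w p) where
  open Group (S̃ n) using (_≈_; _∙_; _⁻¹; ε)
  open AffPerm p

  -- Minimality would turn `s ∙ p ≤L p` into `s ∙ p ≈ p`, yet `s` moves the value `j`.
  noCoveredDescent : ∀ j k → from (j + 1ℤ) < k → k < from j → j + 1ℤ < to k → ⊥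
  noCoveredDescent j k below above high =
    reducible {s = proj₁ g} (proj₂ (proj₂ g)) (at-residue j)
    where
    g = generator (descent⇒2≤n p j (ℤ.<-trans below above)) (residue j)
    reducible : ∀ {i s} → IsGenerator i s → at i j ≡ true → ⊥
    reducible {i} {s} gen at-j = ℤ.<⇒≢ (i<i+1 j) (begin
      j                  ≡⟨ strictlyInverseˡ j ⟨
      to (from j)        ≡⟨ s∙p≈p (from j) ⟨
      s ⟨ to (from j) ⟩  ≡⟨ cong (s ⟨_⟩) (strictlyInverseˡ j) ⟩
      s ⟨ j ⟩            ≡⟨ IsSwap.up (generator⇒isSwap {n} {i} {s} gen) j at-j ⟩
      j + 1ℤ             ∎)
      where
      open ≡-Reasoning
      s∙p≈p : s ∙ p ≈ p
      s∙p≈p = proj₂ minimal (s ∙ p)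
        (≡syl-trans {u = s ∙ p} {p} {w} (generator-≡syl {i = i} {s} gen p at-j below above high) (proj₁ minimal))
        (generator-≤L {i = i} {s} gen p at-j (ℤ.<-trans below above))

  -- Between the values to y and to x there are consecutive values whose positions
  -- lie on either side of k, in decreasing order.
  avoids-231 : ∀ {x k y} → x < k → k < y → to y < to x → to x < to k → ⊥
  avoids-231 {x} {k} {y} x<k k<y py<px px<pk with t , px≡ ← <⇒+suc py<px =
    go (suc t) (to y) (subst (k <_) (sym (strictlyInverseʳ y)) k<y)
      (subst (_< k) (trans (sym (strictlyInverseʳ x)) (cong from px≡)) x<k)
      (subst (_< to k) px≡ px<pk)
    where
    go : ∀ t v → k < from v → from (v + + t) < k → v + + t < to k → ⊥
    go zero    v k<v v<k _ = ℤ.<-asym k<v (subst (λ v → from v < k) (ℤ.+-identityʳ v) v<k)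
    go (suc t) v k<v v+t<k v+t<pk with ℤ.<-cmp (from (v + 1ℤ)) k
    ... | tri< lt _ _ = noCoveredDescent v k lt k<v
          (ℤ.≤-<-trans (ℤ.+-monoʳ-≤ v (ℤ.+≤+ (s≤s z≤n))) v+t<pk)
    -- The scan cannot hit position `k`, because all scanned values stay below `to k`.
    ... | tri≈ _ refl _ = ℤ.<⇒≱ v+t<pk (ℤ.≤-trans (ℤ.≤-reflexive (strictlyInverseˡ (v + 1ℤ)))
          (ℤ.+-monoʳ-≤ v (ℤ.+≤+ (s≤s z≤n))))
    ... | tri> _ _ gt = go t (v + 1ℤ) gt
          (subst (λ v → from v < k) (sym (ℤ.+-assoc v 1ℤ (+ t))) v+t<k)
          (subst (_< to k) (sym (ℤ.+-assoc v 1ℤ (+ t))) v+t<pk)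

  module _ (u : AffPerm n) (u≈wp⁻¹ : u ≈ w ∙ p ⁻¹) where

    -- If the positions of `j` and `j + 1` were comparable in `p`, the congruence would carry their
    -- order over to `w` and `u` would ascend at `j`. A cover with `j + 1` on the left is excluded
    -- by `noCoveredDescent`.
    descent⇒covered : ∀ j → u ⟨ j + 1ℤ ⟩ < u ⟨ j ⟩ →
      ¬ ¬ (∃[ k ] from j < k × k < from (j + 1ℤ) × j + 1ℤ < to k)
    descent⇒covered j descent uncovered = ℤ.<⇒≱ descent
      (subst₂ ℤ._≤_ (sym (u≈wp⁻¹ j)) (sym (u≈wp⁻¹ (j + 1ℤ)))
        (proj₁ (Equivalence.to (proj₁ minimal (from j) (from (j + 1ℤ))) (j≤j+1 , comparable))))
      where
      j≤j+1 : to (from j) ℤ.≤ to (from (j + 1ℤ))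
      j≤j+1 = subst₂ ℤ._≤_ (sym (strictlyInverseˡ j)) (sym (strictlyInverseˡ (j + 1ℤ))) (ℤ.<⇒≤ (i<i+1 j))
      comparable : ¬ Incomparable p (from j ⊓ from (j + 1ℤ)) (from j ⊔ from (j + 1ℤ))
      comparable inc with incomparable⇒covers p (from j) (from (j + 1ℤ)) inc
      ... | k , inj₁ (lo , hi) , _ , high = uncovered (k , lo , hi , subst (_< to k) (strictlyInverseˡ (j + 1ℤ)) high)
      ... | k , inj₂ (lo , hi) , _ , high = noCoveredDescent j k lo hi (subst (_< to k) (strictlyInverseˡ (j + 1ℤ)) high)

    descentAt : ℤ → Bool
    descentAt x = isDescent u (to x - 1ℤ)

    descentAt⇒covered : ∀ x → descentAt x ≡ true →
      ¬ ¬ (∃[ a ] ∃[ k ] a < k × k < x × to a ≡ to x - 1ℤ × to x < to k)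
    descentAt⇒covered x eq none = descent⇒covered j (isDescent⁻ u j eq) λ (k , lo , hi , high) →
      none (from j , k , lo , subst (k <_) (trans (cong from (i-1+1≡i (to x))) (strictlyInverseʳ x)) hi ,
        strictlyInverseˡ j , subst (_< to k) (i-1+1≡i (to x)) high)
      where j = to x - 1ℤ

    -- Take the larger of the values at `x - 1` and `x`, the position of its predecessor and the
    -- cover between them. The smaller value lies below that predecessor, so its position completes
    -- a 231.
    descentAt-isolated : ∀ x → descentAt x ≡ true → descentAt (x - 1ℤ) ≡ true → ⊥
    descentAt-isolated x at-x at-x-1 =
      descentAt⇒covered x at-x λ (a , k , a<k , k<x , pa≡ , px<pk) →
      descentAt⇒covered (x - 1ℤ) at-x-1 λ (a′ , k′ , a′<k′ , k′<x-1 , pa′≡ , px-1<pk′) →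
      let
        a<x-1 = ℤ.<-≤-trans a<k (<⇒≤-1 k<x)
        pa<pk = ℤ.≤-<-trans (ℤ.≤-reflexive pa≡) (ℤ.<-trans (i-1<i (to x)) px<pk)
        pa′<pk′ = ℤ.≤-<-trans (ℤ.≤-reflexive pa′≡) (ℤ.<-trans (i-1<i (to (x - 1ℤ))) px-1<pk′)
        k′<x = ℤ.<-trans k′<x-1 (i-1<i x)
      in case ℤ.<-cmp (to (x - 1ℤ)) (to x) of λ where
        (tri< lt _ _) → avoids-231 a<k
          (ℤ.≤∧≢⇒< (<⇒≤-1 k<x) λ k≡x-1 → ℤ.<-asym lt (subst (to x <_) (cong to k≡x-1) px<pk))
          (ℤ.≤∧≢⇒< (ℤ.≤-trans (<⇒≤-1 lt) (ℤ.≤-reflexive (sym pa≡)))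
            (λ eq → ℤ.<⇒≢ a<x-1 (sym (to-injective p eq))))
          pa<pk
        (tri≈ _ eq _) → ℤ.<⇒≢ (i-1<i x) (to-injective p eq)
        (tri> _ _ gt) → avoids-231 a′<k′ k′<x
          (ℤ.≤∧≢⇒< (ℤ.≤-trans (<⇒≤-1 gt) (ℤ.≤-reflexive (sym pa′≡)))
            (λ eq → ℤ.<⇒≢ (ℤ.<-trans a′<k′ k′<x) (sym (to-injective p eq))))
          pa′<pk′

    -- Both sums count the descents, since j ↦ p⁻¹(j + 1) permutes the residues modulo n.
    ∣D_R∣≤⌊n/2⌋ : ∣ D_R u ∣ ≤ ⌊ n /2⌋
    ∣D_R∣≤⌊n/2⌋ = subst (_≤ ⌊ n /2⌋) (sym (ℕ.n≡⌊n+n/2⌋ ∣ D_R u ∣)) (ℕ.⌊n/2⌋-mono (ℤ.drop‿+≤+ (begin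
      + ∣ D_R u ∣ + + ∣ D_R u ∣
        ≡⟨ cong₂ _+_ (trans D≡ (sym rotate₁)) (trans D≡ (sym rotate₂)) ⟩
      sum {n} (λ k → ⟦ descentAt (pos k) ⟧) + sum {n} (λ k → ⟦ descentAt (pos k - 1ℤ) ⟧)
        ≡⟨ ∑-distrib-+ {n} (λ k → ⟦ descentAt (pos k) ⟧) _ ⟨
      sum {n} (λ k → ⟦ descentAt (pos k) ⟧ + ⟦ descentAt (pos k - 1ℤ) ⟧)
        ≤⟨ sum≤n _ (λ k → ⟦⟧+⟦⟧≤1 _ _ (descentAt-isolated (pos k))) ⟩
      + n ∎)))
      where
      open ℤ.≤-Reasoning
      F : ℤ → ℤ
      F j = ⟦ isDescent u j ⟧
      F-per : ∀ j → F (j + + n) ≡ F j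
      F-per j = cong ⟦_⟧ (isDescent-periodic u j)
      D≡ : + ∣ D_R u ∣ ≡ sum {n} (λ k → F (pos k))
      D≡ = ∣tabulate∣≡sum {n} (isDescent u ∘ pos)
      to-per : ∀ i → to (i + + n) - 1ℤ ≡ to i - 1ℤ + + n
      to-per i = trans (cong (_- 1ℤ) (periodic i)) (+-swapʳ (to i) (+ n) (- 1ℤ))
      from-per : ∀ i → from (i + + n + 1ℤ) ≡ from (i + 1ℤ) + + n
      from-per i = trans (cong from (+-swapʳ i (+ n) 1ℤ)) (from-periodic p (i + 1ℤ))
      rotate₁ : sum {n} (λ k → ⟦ descentAt (pos k) ⟧) ≡ sum {n} (λ k → F (pos k))
      rotate₁ = sum-∘-invariant {n} F F-per (predℤ ↔-∘ perm) to-per from-per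
      rotate₂ : sum {n} (λ k → ⟦ descentAt (pos k - 1ℤ) ⟧) ≡ sum {n} (λ k → F (pos k))
      rotate₂ = sum-∘-invariant {n} F F-per (predℤ ↔-∘ (perm ↔-∘ predℤ))
        (λ i → trans (cong (λ z → to z - 1ℤ) (+-swapʳ i (+ n) (- 1ℤ))) (to-per (i - 1ℤ)))
        (λ i → trans (cong (_+ 1ℤ) (from-per i)) (+-swapʳ (from (i + 1ℤ)) (+ n) 1ℤ))

-- A permutation attaining the bound

-- Marks the even `k` with `k + 1 < n`, so no pair wraps around the period. Counting residues from
-- 0, these are the generators with odd index. The recursion follows that of `⌊_/2⌋`.
pairStart : ℕ → ℕ → Bool
pairStart (suc (suc n)) zero          = true
pairStart (suc (suc n)) (suc (suc k)) = pairStart n k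
pairStart _             _             = false

pairStart-< : ∀ n k → pairStart n k ≡ true → suc k ℕ.< n
pairStart-< (suc (suc n)) zero          eq = s≤s (s≤s z≤n)
pairStart-< (suc (suc n)) (suc (suc k)) eq = s≤s (s≤s (pairStart-< n k eq))

pairStart-isolated : ∀ n k → pairStart n k ≡ true → pairStart n (suc k) ≡ true → ⊥
pairStart-isolated (suc (suc n)) (suc (suc k)) p q = pairStart-isolated n k p q

∣pairStart∣ : ∀ n → ∣ tabulate {n = n} (λ k → pairStart n (toℕ k)) ∣ ≡ ⌊ n /2⌋
∣pairStart∣ zero          = refl
∣pairStart∣ (suc zero)    = refl
∣pairStart∣ (suc (suc n)) = cong suc (∣pairStart∣ n)

-- Permutations with prescribed valleys

module _ {n : ℕ} (χ : ℤ → Bool) (isolated : ∀ i → χ i ≡ true → χ (i + 1ℤ) ≡ true → ⊥) where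

  -- The depth of a valley is left open; this freedom lets `p` and `w` share the shape.
  record HasValleys (f : AffPerm n) : Set where
    field
      ascending : ∀ x y → χ (x - 1ℤ) ≡ false → χ (y - 1ℤ) ≡ false → x < y → f ⟨ x ⟩ < f ⟨ y ⟩
      valley    : ∀ x → χ (x - 1ℤ) ≡ true → f ⟨ x ⟩ < f ⟨ x - 1ℤ ⟩

    non-consecutive : ∀ x → χ (x - 1ℤ) ≡ true → χ (x - 1ℤ - 1ℤ) ≡ false
    non-consecutive x p with χ (x - 1ℤ - 1ℤ) in q
    ... | true  = ⊥-elim (isolated (x - 1ℤ - 1ℤ) q (trans (cong χ (i-1+1≡i (x - 1ℤ))) p))
    ... | false = refl

    below-later : ∀ x y → χ (y - 1ℤ) ≡ false → x < y → f ⟨ x ⟩ < f ⟨ y ⟩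
    below-later x y q x<y with χ (x - 1ℤ) in p
    ... | false = ascending x y p q x<y
    ... | true  = ℤ.<-trans (valley x p)
          (ascending (x - 1ℤ) y (non-consecutive x p) q (ℤ.<-trans (i-1<i x) x<y))

    peak-covers : ∀ x y → χ (y - 1ℤ) ≡ true → x < y - 1ℤ → Covers f (y - 1ℤ) x y
    peak-covers x y q x<y-1 =
      inj₁ (x<y-1 , i-1<i y) , below-later x (y - 1ℤ) (non-consecutive y q) x<y-1 , valley y q

  -- For two positions, the right one decides. If it is no valley, it is the higher; if it is a
  -- valley, its left neighbour either is the other position, and higher, or covers both. All of
  -- this depends on `χ` alone.
  valleys⇒refines : ∀ {f g} → HasValleys f → HasValleys g → Refines f g
  valleys⇒refines {f} {g} F G x y fx<fy with ℤ.<-cmp x y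
  ... | tri≈ _ refl _ = contradiction fx<fy ℤ.i≮i
  ... | tri< x<y _ _ with χ (y - 1ℤ) in q
  ...   | false = inj₁ (HasValleys.below-later G x y q x<y)
  ...   | true with ℤ.<-cmp x (y - 1ℤ)
  ...     | tri< x<y-1 _ _ = inj₂ (y - 1ℤ , HasValleys.peak-covers F x y q x<y-1 , HasValleys.peak-covers G x y q x<y-1)
  ...     | tri≈ _ refl _  = contradiction fx<fy (ℤ.<-asym (HasValleys.valley F y q))
  ...     | tri> _ _ y-1<x = contradiction (ℤ.<-≤-trans y-1<x (<⇒≤-1 x<y)) ℤ.i≮i
  valleys⇒refines {f} {g} F G x y fx<fy | tri> _ _ y<x with χ (x - 1ℤ) in q
  ...   | false = contradiction fx<fy (ℤ.<-asym (HasValleys.below-later F y x q y<x))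
  ...   | true with ℤ.<-cmp y (x - 1ℤ)
  ...     | tri≈ _ refl _  = inj₁ (HasValleys.valley G x q)
  ...     | tri> _ _ x-1<y = contradiction (ℤ.<-≤-trans x-1<y (<⇒≤-1 y<x)) ℤ.i≮i
  ...     | tri< y<x-1 _ _ with HasValleys.peak-covers F y x q y<x-1 | HasValleys.peak-covers G y x q y<x-1
  ...       | b , fy , fx | b′ , gy , gx =
    inj₂ (x - 1ℤ , (between-sym b , fx , fy) , (between-sym b′ , gx , gy))

-- The pairs interleave: the upper end of each pair of `u` is the lower end of a pair of `p`. Since
-- `w` is `u ∙ p`, the point is that `p` is minimal in the class of `w`.
module PairSwaps {n : ℕ} .{{_ : NonZero n}} (α : ℤ → Bool) (u p : AffPerm n)
  (α-swap : IsSwap α (u ⟨_⟩)) (β-swap : IsSwap (λ j → α (j - 1ℤ)) (p ⟨_⟩)) where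
  open Group (S̃ n) using (_≈_; _∙_; _⁻¹; ε)

  w : AffPerm n
  w = u ∙ p

  β : ℤ → Bool
  β j = α (j - 1ℤ)

  open Swap α-swap using () renaming (mono-< to u-mono; ≤-stay to u-≤-stay; ≥-stay to u-≥-stay)
  open Swap β-swap using (isolated) renaming (mono-< to p-mono; involutive to p-involutive; down′ to p-down)

  isDescent≡α : ∀ j → isDescent u j ≡ α j
  isDescent≡α j with α j in eq
  ... | true  = dec-true (_ ℤ.<? _)
        (subst₂ _<_ (sym (IsSwap.down α-swap j eq)) (sym (IsSwap.up α-swap j eq)) (i<i+1 j))
  ... | false = dec-false (_ ℤ.<? _) (ℤ.≤⇒≯ (ℤ.≤-trans (u-≤-stay j eq)
        (ℤ.≤-trans (ℤ.<⇒≤ (i<i+1 j)) (u-≥-stay (j + 1ℤ) (trans (cong α (i+1-1≡i j)) eq)))))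

  p-ascending : ∀ x y → β (y - 1ℤ) ≡ false → x < y → p ⟨ x ⟩ < p ⟨ y ⟩
  p-ascending x y q x<y with p-mono x<y
  ... | inj₁ lt           = lt
  ... | inj₂ (βx , refl) = contradiction (trans (sym βx) (trans (cong β (sym (i+1-1≡i x))) q)) λ ()

  p-valley : ∀ x → β (x - 1ℤ) ≡ true → p ⟨ x ⟩ ≡ x - 1ℤ × p ⟨ x - 1ℤ ⟩ ≡ x
  p-valley x q = p-down x q , trans (IsSwap.up β-swap (x - 1ℤ) q) (i-1+1≡i x)

  p-valleys : HasValleys β isolated p
  p-valleys = record
    { ascending = λ x y _ → p-ascending x y
    ; valley    = λ x q → subst₂ _<_ (sym (proj₁ (p-valley x q))) (sym (proj₂ (p-valley x q))) (i-1<i x)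
    }

  w-valleys : HasValleys β isolated w
  w-valleys = record { ascending = ascending ; valley = valley }
    where
    ascending : ∀ x y → β (x - 1ℤ) ≡ false → β (y - 1ℤ) ≡ false → x < y → w ⟨ x ⟩ < w ⟨ y ⟩
    ascending x y _ q x<y with u-mono (p-ascending x y q x<y)
    ... | inj₁ lt = lt
    -- A reversal by `u` would make `p ⟨ y ⟩` the upper end of an `α` pair, hence the lower end of a
    -- `β` pair, and `y` would be a valley.
    ... | inj₂ (αpx , py≡px+1) = contradiction (trans (sym βpy) (trans (cong β (sym y-1≡py)) q)) λ ()
      where
      βpy : β (p ⟨ y ⟩) ≡ true
      βpy = trans (cong α (pred-of-suc (p ⟨ x ⟩) py≡px+1)) αpx
      y-1≡py : y - 1ℤ ≡ p ⟨ y ⟩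
      y-1≡py = pred-of-suc (p ⟨ y ⟩) (trans (sym (p-involutive y)) (IsSwap.up β-swap (p ⟨ y ⟩) βpy))
    valley : ∀ x → β (x - 1ℤ) ≡ true → w ⟨ x ⟩ < w ⟨ x - 1ℤ ⟩
    valley x q = subst₂ _<_ (cong (u ⟨_⟩) (sym (proj₁ (p-valley x q)))) (cong (u ⟨_⟩) (sym (proj₂ (p-valley x q)))) lt
      where
      lt : u ⟨ x - 1ℤ ⟩ < u ⟨ x ⟩
      lt with u-mono (i-1<i x)
      ... | inj₁ lt      = lt
      ... | inj₂ (βx , _) = ⊥-elim (isolated (x - 1ℤ) q (trans (cong β (i-1+1≡i x)) βx))

  p≡w : p ≡syl w
  p≡w = refines⇒≡syl {p = p} {w}
    (valleys⇒refines β isolated {p} {w} p-valleys w-valleys)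
    (valleys⇒refines β isolated {w} {p} w-valleys p-valleys)

  -- The inverted positions of p are adjacent, hence comparable, hence inverted in all of its class.
  inversions-⊆ : ∀ v → v ≡syl p → ∀ L → inversions p L ⊆ inversions v L
  inversions-⊆ v v≡p L {q} q∈ = inversion⁺ v (ℤ.≤∧≢⇒<
    (proj₁ (Equivalence.from (v≡p j i) (ℤ.<⇒≤ pj<pi , uncovered ∘ incomparable⇒covers p j i)))
    (ℤ.<⇒≢ i<j ∘ sym ∘ to-injective v))
    where
    i = first {L = L} q
    j = second {L = L} q
    i<j = first<second {L = L} q
    pj<pi = inversion⁻ p {L} q∈
    j≡i+1 : j ≡ i + 1ℤ
    j≡i+1 with p-mono i<j
    ... | inj₁ pi<pj    = contradiction pi<pj (ℤ.<-asym pj<pi)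
    ... | inj₂ (_ , eq) = eq
    uncovered : ¬ (∃[ k ] Covers p k j i)
    uncovered (k , inj₁ (j<k , k<i) , _) = ℤ.<-asym i<j (ℤ.<-trans j<k k<i)
    uncovered (k , inj₂ (i<k , k<j) , _) = ℤ.<⇒≱ i<k (<+1⇒≤ (subst (k <_) j≡i+1 k<j))

  -- The length of `p` is its inversion count, which is at most that of `v` and so at most the
  -- length of `v`. Then `p ∙ v ⁻¹` has length 0.
  p-least : ∀ v → v ≡syl p → v ≤L p → v ≈ p
  p-least v v≡p (a , b , c , (v⁻¹-word , _) , (_ , b-least) , ((ss , ss-word) , _) , a≡b-c) x = trans
    (trivial {p ∙ v ⁻¹} (subst (λ a → ∃[ ss ] IsWordFor {k = a} (p ∙ v ⁻¹) ss) a≡0 v⁻¹-word) (v ⟨ x ⟩))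
    (cong (p ⟨_⟩) (AffPerm.strictlyInverseʳ v x))
    where
    b≤c : b ≤ c
    b≤c = compare (∃-boundedInversions p)
      where
      compare : ∃[ L ] BoundedInversions p L → b ≤ c
      compare (L , bounded) = ℕ.≤-trans (b-least _ (proj₁ p-word) (proj₂ p-word))
        (ℕ.≤-trans (p⊆q⇒∣p∣≤∣q∣ (inversions-⊆ v v≡p L)) (∣inversions∣≤length v ss ss-word L))
        where p-word = word L ∣ inversions p L ∣ p bounded refl
    a+c≡b : a ℕ.+ c ≡ b
    a+c≡b = ℤ.+-injective (trans (cong (_+ + c) a≡b-c) (lem (+ b) (+ c)))
      where
      lem : ∀ b c → b - c + c ≡ b
      lem = solve-∀
    a≡0 : a ≡ 0
    a≡0 = ℕ.n≤0⇒n≡0 (ℕ.+-cancelʳ-≤ c a 0 (subst (_≤ c) (sym a+c≡b) b≤c))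
    trivial : ∀ {y} → ∃[ ss ] IsWordFor {k = 0} y ss → ε ≈ y
    trivial ([] , eq) = eq

  p-minimal : IsMinimalInClassOf w p
  p-minimal = p≡w , λ v v≡w →
    p-least v (≡syl-trans {u = v} {w} {p} v≡w (≡syl-sym {v = p} {w} p≡w))

  stackSort : IsStackSortOf w u
  stackSort = p , p-minimal , λ j → cong (u ⟨_⟩) (sym (AffPerm.strictlyInverseˡ p j))

residue-suc : ∀ {n} .{{_ : NonZero n}} j → suc (toℕ (residue {n} j)) ℕ.< n →
  toℕ (residue {n} (j + 1ℤ)) ≡ suc (toℕ (residue {n} j))
residue-suc {n} j lt = trans (cong toℕ (trans (cong residue (begin
  j + 1ℤ                                ≡⟨ cong (_+ 1ℤ) (residue-quot {n} j) ⟩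
  pos r + quot {n} j * + n + 1ℤ         ≡⟨ lem (pos r) (quot {n} j * + n) ⟩
  1ℤ + pos r + quot {n} j * + n         ≡⟨ cong (λ k → 1ℤ + + k + quot {n} j * + n) (Fin.toℕ-fromℕ< lt) ⟨
  pos (fromℕ< lt) + quot {n} j * + n    ∎)) (residue-orbit (fromℕ< lt) (quot {n} j)))) (Fin.toℕ-fromℕ< lt)
  where
  open ≡-Reasoning
  r = residue {n} j
  lem : ∀ r q → r + q + 1ℤ ≡ 1ℤ + r + q
  lem = solve-∀

attained : ∀ n .{{_ : NonZero n}} → ∃[ w ] ∃[ u ] IsStackSortOf {n} w u × ⌊ n /2⌋ ≡ ∣ D_R u ∣
attained n = w , u , stackSort , sym (trans
  (cong ∣_∣ (tabulate-cong λ k → trans (isDescent≡α (pos k)) (cong (pairStart n ∘ toℕ)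
    (trans (cong residue (sym (ℤ.+-identityʳ (pos k)))) (residue-orbit k 0ℤ)))))
  (∣pairStart∣ n))
  where
  α β : ℤ → Bool
  α j = pairStart n (toℕ (residue {n} j))
  β j = α (j - 1ℤ)
  α-periodic : ∀ j → α (j + + n) ≡ α j
  α-periodic j = cong (pairStart n ∘ toℕ) (residue-periodic j)
  β-periodic : ∀ j → β (j + + n) ≡ β j
  β-periodic j = trans (cong α (+-swapʳ j (+ n) (- 1ℤ))) (α-periodic (j - 1ℤ))
  α-isolated : ∀ j → α j ≡ true → α (j + 1ℤ) ≡ true → ⊥
  -- The mark at `j` keeps `j + 1` in the same period, so their residues are consecutive.
  α-isolated j p q = pairStart-isolated n _ p
    (trans (cong (pairStart n) (sym (residue-suc j (pairStart-< n _ p)))) q)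
  β-isolated : ∀ j → β j ≡ true → β (j + 1ℤ) ≡ true → ⊥
  β-isolated j p q = α-isolated (j - 1ℤ) p
    (trans (cong α (trans (i-1+1≡i j) (sym (i+1-1≡i j)))) q)
  u = swapPerm α α-periodic α-isolated
  open PairSwaps α u (swapPerm β β-periodic β-isolated)
    (swap-isSwap α α-isolated) (swap-isSwap β β-isolated)

theorem8p3 : (n : ℕ) → 1 ≤ n →
    IsMaximum (λ k → ∃[ w ] ∃[ u ] IsStackSortOf {n} w u × k ≡ ∣ D_R u ∣) ⌊ n /2⌋
theorem8p3 n@(suc _) _ = attained n ,
  λ { _ (w , u , (p , minimal , u≈wp⁻¹) , refl) → Minimal.∣D_R∣≤⌊n/2⌋ w p minimal u u≈wp⁻¹ }
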